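{- The formulas $\mathcal{G}(\mathrm{BPHP}_n)$ admit $\mathsf{RAT}^-$ proofs of size $n^{O(1)}$, but every $\mathsf{SBC}^-$ proof of $\mathcal{G}(\mathrm{BPHP}_n)$ has size $2^{\Omega(n)}$.
   Context: A literal is a variable $v$ or its negation $\bar v$. A clause is a nontautological set of literals; $\bot$ is the empty clause; a formula is a finite set of clauses; $\mathrm{var}(\Gamma)$ is its set of variables. For a set $L$ of literals, $\bar L=\{\bar\ell:\ell\in L\}$. $D$ is a weakening of $C$ if $C\subseteq D$. If $C\cup\{x\}$, $D\cup\{\bar x\}$ are clauses with $x,\bar x\notin C\cup D$ and $C\cup D$ nontautological, $C\cup D$ is their resolvent. For a clause $C$ and formula $\Delta$, $C\vee\Delta=\{C\cup D: D\in\Delta,\ C\cup D \text{ nontautological}\}$. Resolution proof of $\Gamma$: sequence of formulas $(\Gamma_1,\dots,\Gamma_N)$, $\Gamma_1=\Gamma$, $\bot\in\Gamma_N$, each $\Gamma_{i+1}=\Gamma_i\cup\{C\}$ with $C$ a resolvent of two clauses of $\Gamma_i$ or a weakening of a clause of $\Gamma_i$; size $N$. A unit propagation proof is a resolution proof in which every resolution step has a premise consisting of a single literal. For a set of literals $L=\{\ell_1,\dots,\ell_k\}$, $\Gamma\vdash_1 L$ means there is a unit propagation proof of $\Gamma\cup\{\{\bar\ell_1\},\dots,\{\bar\ell_k\}\}$. A clause $C=\{p\}\cup C'$ ($p\notin C'$) is a resolution asymmetric tautology (RAT) for $p$ w.r.t. $\Gamma$ if for every clause $\{\bar p\}\cup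 D'\in\Gamma$ ($\bar p\notin D'$) we have $\Gamma\vdash_1 C'\cup D'$. $C$ is a set-blocked clause (SBC) for nonempty $L\subseteq C$ w.r.t. $\Gamma$ if for every $D\in\Gamma$ with $D\cap\bar L\ne\varnothing$, $D\cap L=\varnothing$, the set $(C\setminus L)\cup(D\setminus\bar L)$ is tautological. An $\mathsf{RAT}$ (resp. $\mathsf{SBC}$) proof is like a resolution proof but additionally allows adding a clause that is a RAT (resp. SBC) w.r.t. the current $\Gamma_i$; the $^-$ versions require every variable in the proof to lie in $\mathrm{var}(\Gamma)$. Size is the number $N$ of formulas in the sequence. Extended resolution ($\mathsf{ER}$): for a formula $\Delta$, literals $p,q$ and a variable $x$ not occurring in $\Delta,p,q$, $\{\bar x\vee p,\ \bar x\vee q,\ x\vee\bar p\vee\bar q\}$ is a set of extension clauses for $\Delta$. $\Lambda$ is an extension for $\Gamma$ if $\Lambda=\bigcup_{i=1}^t\lambda_i$ with each $\lambda_i$ a set of extension clauses for $\Gamma\cup\lambda_1\cup\dots\cup\lambda_{i-1}$. An $\mathsf{ER}$ proof of $\Gamma$ is a pair $(\Lambda,\Pi)$ with $\Lambda$ an extension for $\Gamma$ and $\Pi$ a resolution proof of $\Gamma\cup\Lambda$; size $|\Lambda|+|\Pi|$. Construction: for unsatisfiable $\Gamma$, fix a minimum-size $\mathsf{ER}$ proof $(\Lambda,\Pi)$ of $\Gamma$, $\Lambda$ being the union of $t(\Gamma)=|\Lambda|/3$ sets $\lambda_i=\{\bar x_i\vee p_i,\ \bar x_i\vee q_i,\ x_i\vee\bar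 p_i\vee\bar q_i\}$ with extension variables $x_1,\dots,x_{t(\Gamma)}$. Define $\mathcal{G}(\Gamma)=\Gamma\cup\bigcup_{i=1}^{t(\Gamma)}\big[(x_i\vee\Gamma)\cup(\bar x_i\vee\Gamma)\big]$. Bit pigeonhole principle: for $n=2^k$, $k\ge1$, variables $p^x_\ell$ ($x\in[n+1]$, $\ell\in[k]$); writing "$v\neq0$" for $v$ and "$v\neq1$" for $\bar v$, $\mathrm{BPHP}_n$ is the set of clauses $\bigvee_{\ell=1}^k (p^x_\ell\neq h_\ell)\vee\bigvee_{\ell=1}^k(p^y_\ell\neq h_\ell)$ over all $x\ne y$ in $[n+1]$ and $h\in\{0,1\}^k$. For other $n\ge2$, $\mathrm{BPHP}_n:=\mathrm{BPHP}_m$ with $m$ the largest power of two $\le n$. -}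

module Defs where

open import Data.Nat using (ℕ; zero; suc; _+_; _*_; _^_; _≤_; _≡ᵇ_)
open import Data.Nat.Logarithm using (⌊log₂_⌋)
import Data.Nat as N
open import Data.Bool using (Bool; true; false; if_then_else_)
open import Data.Fin using (Fin; toℕ)
open import Data.Vec using (Vec; lookup) renaming ([] to []ᵥ; _∷_ to _∷ᵥ_)
open import Data.List using (List; []; _∷_; _++_; map; filter; concatMap; upTo; allFin; length)
open import Data.Product using (Σ; _×_; _,_)
open import Data.Sum using (_⊎_)
open import Relation.Nullary using (¬_; yes; no; ¬?)
open import Relation.Binary.PropositionalEquality using (_≡_; _≢_; refl; cong)
open import Relation.Binary.Definitions using (DecidableEquality)

-- Literals, clauses, formulas
-- Variables are natural numbers.  A clause is represented by a list of
-- literals read as the SET of its elements; a formula is a list of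
-- clauses read as the set of its elements.

data Lit : Set where
  pos : ℕ → Lit
  neg : ℕ → Lit

var : Lit → ℕ
var (pos v) = v
var (neg v) = v

negate : Lit → Lit
negate (pos v) = neg v
negate (neg v) = pos v

_≟ₗ_ : DecidableEquality Lit
pos a ≟ₗ pos b with a N.≟ b
... | yes refl = yes refl
... | no ne = no (λ { refl → ne refl })
pos a ≟ₗ neg b = no (λ ())
neg a ≟ₗ pos b = no (λ ())
neg a ≟ₗ neg b with a N.≟ b
... | yes refl = yes refl
... | no ne = no (λ { refl → ne refl })

open import Data.List.Membership.Propositional using (_∈_; _∉_)
open import Data.List.Membership.DecPropositional _≟ₗ_ using (_∈?_)

Clause : Set
Clause = List Lit

Formula : Set
Formula = List Clause

Taut : List Lit → Set
Taut C = Σ ℕ λ v → pos v ∈ C × neg v ∈ C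

IsClause : List Lit → Set
IsClause C = ¬ Taut C

Rule : Set₁
Rule = Formula → Clause → Set

record ResolutionOf (Γ : Formula) (R : Clause) : Set where
  field
    C1 C2 : Clause
    C1∈ : C1 ∈ Γ
    C2∈ : C2 ∈ Γ
    pivot : Lit
    pivot∈ : pivot ∈ C1
    npivot∈ : negate pivot ∈ C2
    isClause : IsClause R
    sound : ∀ l → l ∈ R → (l ∈ C1 × l ≢ pivot) ⊎ (l ∈ C2 × l ≢ negate pivot)
    complete : ∀ l → (l ∈ C1 × l ≢ pivot) ⊎ (l ∈ C2 × l ≢ negate pivot) → l ∈ R

UnitResolutionOf : Rule
UnitResolutionOf Γ R = Σ (ResolutionOf Γ R) λ r →
  (∀ l → l ∈ ResolutionOf.C1 r → l ≡ ResolutionOf.pivot r)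
  ⊎ (∀ l → l ∈ ResolutionOf.C2 r → l ≡ negate (ResolutionOf.pivot r))

Weakening : Rule
Weakening Γ R = IsClause R × Σ Clause λ D → D ∈ Γ × (∀ l → l ∈ D → l ∈ R)

-- A proof with rule R of Γ of size N: a sequence Γ = Γ₁, …, Γ_N with
-- Γ_{i+1} = Γ_i ∪ {C}, C allowed by R w.r.t. Γ_i, and ⊥ ∈ Γ_N.
data Proof (R : Rule) : Formula → ℕ → Set where
  done : ∀ {Γ} → [] ∈ Γ → Proof R Γ 1
  add  : ∀ {Γ C n} → R Γ C → Proof R (C ∷ Γ) n → Proof R Γ (suc n)

ResRule : Rule
ResRule Γ C = ResolutionOf Γ C ⊎ Weakening Γ C

UPRule : Rule
UPRule Γ C = UnitResolutionOf Γ C ⊎ Weakening Γ C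

_⊢₁_ : Formula → List Lit → Set
Γ ⊢₁ L = Σ ℕ λ N → Proof UPRule (map (λ l → negate l ∷ []) L ++ Γ) N

remove : Lit → Clause → Clause
remove p = filter (λ l → ¬? (l ≟ₗ p))

RAT : Rule
RAT Γ C = IsClause C × Σ Lit λ p → p ∈ C ×
  (∀ D → D ∈ Γ → negate p ∈ D → Γ ⊢₁ (remove p C ++ remove (negate p) D))

SBC : Rule
SBC Γ C = IsClause C × Σ (List Lit) λ L → L ≢ [] × (∀ l → l ∈ L → l ∈ C) ×
  (∀ D → D ∈ Γ → (Σ Lit λ l → l ∈ L × negate l ∈ D) → (∀ l → l ∈ L → l ∉ D) →
     let In : Lit → Set
         In l = (l ∈ C × l ∉ L) ⊎ (l ∈ D × negate l ∉ L)
     in Σ ℕ λ v → In (pos v) × In (neg v))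

RATRule : Rule
RATRule Γ C = ResolutionOf Γ C ⊎ Weakening Γ C ⊎ RAT Γ C

SBCRule : Rule
SBCRule Γ C = ResolutionOf Γ C ⊎ Weakening Γ C ⊎ SBC Γ C

Occurs : ℕ → Formula → Set
Occurs v Δ = Σ Clause λ D → D ∈ Δ × Σ Lit λ l → l ∈ D × var l ≡ v

Restricted : Formula → Rule → Rule
Restricted Γ₀ R Γ C = R Γ C × (∀ l → l ∈ C → Occurs (var l) Γ₀)

RAT⁻Proof : Formula → ℕ → Set
RAT⁻Proof Γ N = Proof (Restricted Γ RATRule) Γ N

SBC⁻Proof : Formula → ℕ → Set
SBC⁻Proof Γ N = Proof (Restricted Γ SBCRule) Γ N

ExtTriple : Set
ExtTriple = ℕ × Lit × Lit

extClauses : ExtTriple → Formula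
extClauses (x , p , q) =
  (neg x ∷ p ∷ []) ∷ (neg x ∷ q ∷ []) ∷ (pos x ∷ negate p ∷ negate q ∷ []) ∷ []

data ValidExt : Formula → List ExtTriple → Set where
  []  : ∀ {Δ} → ValidExt Δ []
  ext : ∀ {Δ x p q es} → ¬ Occurs x Δ → x ≢ var p → x ≢ var q →
        IsClause (pos x ∷ negate p ∷ negate q ∷ []) →
        ValidExt (Δ ++ extClauses (x , p , q)) es →
        ValidExt Δ ((x , p , q) ∷ es)

record ERProof (Γ : Formula) : Set where
  field
    exts  : List ExtTriple
    valid : ValidExt Γ exts
    len   : ℕ
    res   : Proof ResRule (Γ ++ concatMap extClauses exts) len

erSize : ∀ {Γ} → ERProof Γ → ℕ
erSize π = 3 * length (ERProof.exts π) + ERProof.len π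

orLit : Lit → Formula → Formula
orLit l Δ = map (l ∷_) (filter (λ D → ¬? (negate l ∈? D)) Δ)

-- 𝒢(Γ) built from a (minimum-size) ER proof π of Γ
𝒢 : (Γ : Formula) → ERProof Γ → Formula
𝒢 Γ π = Γ ++ concatMap (λ { (x , _ , _) → orLit (pos x) Γ ++ orLit (neg x) Γ }) (ERProof.exts π)

neqLit : ℕ → Bool → Lit
neqLit v b = if b then neg v else pos v

allVecs : (k : ℕ) → List (Vec Bool k)
allVecs zero = []ᵥ ∷ []
allVecs (suc k) = concatMap (λ v → (false ∷ᵥ v) ∷ (true ∷ᵥ v) ∷ []) (allVecs k)

-- variable p^x_ℓ (pigeons x ∈ {0,…,2^k}, bits ℓ ∈ Fin k)
pvar : (k : ℕ) → ℕ → Fin k → ℕ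
pvar k x ℓ = x * k + toℕ ℓ

bphpClause : (k : ℕ) → ℕ → ℕ → Vec Bool k → Clause
bphpClause k x y h =
  map (λ ℓ → neqLit (pvar k x ℓ) (lookup h ℓ)) (allFin k) ++
  map (λ ℓ → neqLit (pvar k y ℓ) (lookup h ℓ)) (allFin k)

bphpPow : ℕ → Formula
bphpPow k = concatMap (λ x → concatMap (λ y →
              if x ≡ᵇ y then [] else map (bphpClause k x y) (allVecs k))
            pigeons) pigeons
  where pigeons = upTo (suc (2 ^ k))

-- BPHP_n = BPHP_m, m = 2^⌊log₂ n⌋ the largest power of two ≤ n
BPHP : ℕ → Formula
BPHP n = bphpPow ⌊log₂ n ⌋

{-# OPTIONS --safe #-}

-- Upper bound: Cook's reduction of m + 1 pigeons and m holes to m pigeons and m - 1 holes gives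
-- BPHP an ER proof of polynomial size, so the minimum-size ER proof is polynomial too. A RAT⁻
-- proof of 𝒢(Γ) can replay it: x ∨ Γ and x̄ ∨ Γ are implied by Γ, so they do not obstruct adding
-- the extension clauses of x as RATs.
-- Lower bound: 𝒢(Γ) leaves set-blockedness no room, as any SBC clause must mention all pigeons
-- but one. A greedily chosen partial matching on a quarter of the pigeons satisfies every clause
-- of a short proof that mentions at least half of the pigeons. What remains is a resolution
-- derivation through clauses with few pigeons, and none of these is falsified by a partial
-- matching extending the chosen one, whereas the empty clause is.
module Submission where

open import Defs
open import Data.Bool using (Bool; true; false; if_then_else_; not; _∨_; _∧_)
import Data.Bool as Bool
open import Data.Nat
open import Data.Nat.Properties
open import Data.Nat.DivMod
open import Data.Nat.Divisibility using (divides-refl)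
open import Data.Nat.Logarithm
open import Data.Nat.Tactic.RingSolver using (solve-∀)
open import Data.Empty
open import Data.Fin using (Fin; zero; suc; toℕ)
open import Data.Fin.Properties using (toℕ-injective; toℕ-fromℕ<; toℕ<n)
open import Data.List using (List; []; _∷_; _++_; map; filter; concatMap; upTo; length; allFin)
open import Data.List.Properties using (length-upTo; length-map; length-++; length-filter; length-tabulate; ++-identityʳ)
open import Data.List.Membership.Propositional using (_∈_; _∉_; find; lose)
open import Data.List.Membership.Propositional.Properties
open import Data.List.Membership.DecPropositional _≟ₗ_ using (_∈?_)
import Data.List.Relation.Unary.All as All
import Data.List.Relation.Unary.AllPairs as AllPairs
open import Data.List.Relation.Unary.Any as Any using (Any; here; there; any?)
open import Data.List.Relation.Unary.Unique.Propositional using (Unique)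
open import Data.List.Relation.Unary.Unique.Propositional.Properties using (upTo⁺)
open import Data.Product using (Σ; ∃; _×_; _,_; proj₁; proj₂)
open import Data.Sum using (_⊎_; inj₁; inj₂)
open import Data.Vec using (Vec; lookup; tabulate; replicate) renaming ([] to []ᵥ; _∷_ to _∷ᵥ_)
open import Data.Vec.Properties using (≡-dec; lookup∘tabulate)
open import Data.Vec.Relation.Binary.Pointwise.Extensional using (Pointwise-≡⇒≡) renaming (ext to pointwise)
open import Function using (_∘_; id)
open import Relation.Nullary hiding (True)
open import Relation.Nullary.Decidable using (dec-true; dec-false; _×-dec_; map′)
open import Relation.Unary using (Decidable)
open import Relation.Binary.Definitions using (DecidableEquality)
open import Relation.Binary.PropositionalEquality hiding (J)

-- The clauses x ∨ Γ and x̄ ∨ Γ separate the two systems because of how each tests a clause. The RAT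
-- test may call on Γ: combining a clause on x with x̄ ∨ D leaves a superset of D ∈ Γ, which unit
-- propagation refutes at once. Set-blockedness asks for an outright tautology, and a BPHP clause at
-- a well-chosen hole prevents one, whichever sign the literals of `L` have. The ER proof inside `𝒢`
-- is arbitrary apart from its size, so neither half may rely on its shape. In the lower bound the
-- extension variables may occur anywhere in the proof. They become bits of phantom pigeons from
-- whom no injectivity is demanded; as every clause of `𝒢` is a BPHP clause or a weakening of one,
-- resolving on such a variable uses up no hole. In the upper bound the ER proof may contain
-- variables that do not occur in `𝒢`, which RAT⁻ forbids, so these must be eliminated during the
-- replay.

^-distribʳ-* : ∀ o m n → (m * n) ^ o ≡ m ^ o * n ^ o
^-distribʳ-* zero    m n = refl
^-distribʳ-* (suc o) m n rewrite ^-distribʳ-* o m n = lemma m n (m ^ o) (n ^ o)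
  where
  lemma : ∀ a b c d → a * b * (c * d) ≡ a * c * (b * d)
  lemma = solve-∀

-- Finite sums, averaging and indicator counting.

∑ : {A : Set} → List A → (A → ℕ) → ℕ
∑ []       f = 0
∑ (x ∷ xs) f = f x + ∑ xs f

∑-mono : {A : Set} (xs : List A) {f g : A → ℕ} → (∀ x → x ∈ xs → f x ≤ g x) → ∑ xs f ≤ ∑ xs g
∑-mono []       h = z≤n
∑-mono (x ∷ xs) h = +-mono-≤ (h x (here refl)) (∑-mono xs (λ y y∈ → h y (there y∈)))

∑-+ : {A : Set} (xs : List A) (f g : A → ℕ) → ∑ xs (λ x → f x + g x) ≡ ∑ xs f + ∑ xs g
∑-+ []       f g = refl
∑-+ (x ∷ xs) f g rewrite ∑-+ xs f g = lemma (f x) (g x) (∑ xs f) (∑ xs g)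
  where
  lemma : ∀ a b c d → (a + b) + (c + d) ≡ (a + c) + (b + d)
  lemma = solve-∀

∑-const : {A : Set} (xs : List A) (c : ℕ) → ∑ xs (λ _ → c) ≡ length xs * c
∑-const []       c = refl
∑-const (x ∷ xs) c = cong (c +_) (∑-const xs c)

∑-*ʳ : {A : Set} (xs : List A) (f : A → ℕ) (c : ℕ) → ∑ xs (λ x → f x * c) ≡ ∑ xs f * c
∑-*ʳ []       f c = refl
∑-*ʳ (x ∷ xs) f c rewrite ∑-*ʳ xs f c = sym (*-distribʳ-+ c (f x) (∑ xs f))

∑-swap : {A B : Set} (xs : List A) (ys : List B) (f : A → B → ℕ) →
         ∑ xs (λ x → ∑ ys (f x)) ≡ ∑ ys (λ y → ∑ xs (λ x → f x y))
∑-swap []       ys f rewrite ∑-const ys 0 | *-zeroʳ (length ys) = refl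
∑-swap (x ∷ xs) ys f rewrite ∑-swap xs ys f = sym (∑-+ ys (f x) _)

-- The witness is a maximal term, so no division is involved.
∑-average : ∀ {A : Set} {x : A} {xs} → x ∈ xs → (f : A → ℕ) →
            ∃ λ y → y ∈ xs × ∑ xs f ≤ length xs * f y
∑-average {xs = x ∷ []} _ f = x , here refl , ≤-refl
∑-average {xs = x ∷ x₁ ∷ xs} _ f with ∑-average {xs = x₁ ∷ xs} (here refl) f
... | y , y∈ , h with ≤-total (f x) (f y)
... | inj₁ fx≤fy = y , there y∈ , +-mono-≤ fx≤fy h
... | inj₂ fy≤fx = x , here refl ,
      +-monoʳ-≤ (f x) (≤-trans h (*-monoʳ-≤ (length (x₁ ∷ xs)) fy≤fx))

∑-zero : {A : Set} (xs : List A) (f : A → ℕ) → ∑ xs f < length xs → ∃ λ x → x ∈ xs × f x ≡ 0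
∑-zero (x ∷ xs) f lt with f x in eq
... | zero  = x , here refl , eq
... | suc c with ∑-zero xs f (≤-<-trans (m≤n+m _ c) (s<s⁻¹ lt))
...   | y , y∈ , e = y , there y∈ , e

⟦_⟧ : {P : Set} → Dec P → ℕ
⟦ d ⟧ = if does d then 1 else 0

⟦yes⟧ : {P : Set} (d : Dec P) → P → ⟦ d ⟧ ≡ 1
⟦yes⟧ (yes _) p = refl
⟦yes⟧ (no ¬p) p = ⊥-elim (¬p p)

⟦no⟧ : {P : Set} (d : Dec P) → ⟦ d ⟧ ≡ 0 → ¬ P
⟦no⟧ (no ¬p) _ = ¬p

⟦⟧-cover : {P Q R : Set} (d : Dec P) (e : Dec Q) (c : Dec R) → (P → Q ⊎ R) → ⟦ d ⟧ ≤ ⟦ e ⟧ + ⟦ c ⟧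
⟦⟧-cover (no _)  e c f = z≤n
⟦⟧-cover (yes p) e c f with f p
... | inj₁ q rewrite ⟦yes⟧ e q = s≤s z≤n
... | inj₂ r rewrite ⟦yes⟧ c r = m≤n+m 1 ⟦ e ⟧

⟦⟧-either : {P Q : Set} (d : Dec P) (e : Dec Q) → P ⊎ Q → 1 ≤ ⟦ d ⟧ + ⟦ e ⟧
⟦⟧-either d e (inj₁ p) rewrite ⟦yes⟧ d p = s≤s z≤n
⟦⟧-either d e (inj₂ q) rewrite ⟦yes⟧ e q = m≤n+m 1 ⟦ d ⟧

∑-witness : {A : Set} {P : A → Set} (P? : Decidable P) (xs : List A) → 1 ≤ ∑ xs (λ x → ⟦ P? x ⟧) → ∃ P
∑-witness P? (x ∷ xs) h with P? x
... | yes p = x , p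
... | no _  = ∑-witness P? xs h

length-filter≡∑ : {A : Set} {P : A → Set} (P? : Decidable P) (xs : List A) →
                  length (filter P? xs) ≡ ∑ xs (λ x → ⟦ P? x ⟧)
length-filter≡∑ P? [] = refl
length-filter≡∑ P? (x ∷ xs) with P? x
... | yes _ = cong suc (length-filter≡∑ P? xs)
... | no  _ = length-filter≡∑ P? xs

length-filter-¬ : {A : Set} {P : A → Set} (P? : Decidable P) (xs : List A) →
                  length (filter (λ x → ¬? (P? x)) xs) + ∑ xs (λ x → ⟦ P? x ⟧) ≡ length xs
length-filter-¬ P? [] = refl
length-filter-¬ P? (x ∷ xs) with P? x
... | yes _ = trans (+-suc _ _) (cong suc (length-filter-¬ P? xs))
... | no  _ = cong suc (length-filter-¬ P? xs)

module Membership {A : Set} (_≟ₐ_ : DecidableEquality A) where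
  open import Data.List.Membership.DecPropositional _≟ₐ_ using () renaming (_∈?_ to _∈ₐ?_)

  -- Each entry of `ys` accounts for at most one entry of `xs`. This bounds the pigeons and the
  -- holes that a partial matching occupies.
  ∑-∈≤length : (xs : List A) → (∀ t → ∑ xs (λ x → ⟦ x ≟ₐ t ⟧) ≤ 1) →
               (ys : List A) → ∑ xs (λ x → ⟦ x ∈ₐ? ys ⟧) ≤ length ys
  ∑-∈≤length xs once [] =
    ≤-reflexive (trans (∑-const xs 0) (*-zeroʳ (length xs)))
  ∑-∈≤length xs once (y ∷ ys) = begin
    ∑ xs (λ x → ⟦ x ∈ₐ? (y ∷ ys) ⟧)             ≤⟨ ∑-mono xs (λ x _ → ⟦⟧-cover (x ∈ₐ? (y ∷ ys)) (x ≟ₐ y) (x ∈ₐ? ys) split) ⟩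
    ∑ xs (λ x → ⟦ x ≟ₐ y ⟧ + ⟦ x ∈ₐ? ys ⟧)       ≡⟨ ∑-+ xs _ _ ⟩
    ∑ xs (λ x → ⟦ x ≟ₐ y ⟧) + ∑ xs (λ x → ⟦ x ∈ₐ? ys ⟧) ≤⟨ +-mono-≤ (once y) (∑-∈≤length xs once ys) ⟩
    suc (length ys)                             ∎
    where
    open ≤-Reasoning
    split : ∀ {x} → x ∈ y ∷ ys → x ≡ y ⊎ x ∈ ys
    split (here e)  = inj₁ e
    split (there i) = inj₂ i

  unique⇒once : (xs : List A) → Unique xs → ∀ t → ∑ xs (λ x → ⟦ x ≟ₐ t ⟧) ≤ 1
  unique⇒once [] _ t = z≤n
  unique⇒once (x ∷ xs) (x∉ AllPairs.∷ u) t with x ≟ₐ t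
  ... | no _     = unique⇒once xs u t
  ... | yes refl = s≤s (≤-reflexive (absent xs x∉))
    where
    absent : ∀ zs → All.All (x ≢_) zs → ∑ zs (λ z → ⟦ z ≟ₐ x ⟧) ≡ 0
    absent [] _ = refl
    absent (z ∷ zs) (x≢z All.∷ h) with z ≟ₐ x
    ... | yes e = ⊥-elim (x≢z (sym e))
    ... | no  _ = absent zs h

∑-upTo-once : ∀ n t → ∑ (upTo n) (λ x → ⟦ x ≟ t ⟧) ≤ 1
∑-upTo-once n = Membership.unique⇒once _≟_ (upTo n) (upTo⁺ n)

-- Counting holes, that is, bit vectors of length k.

infix 4 _≟ₕ_
_≟ₕ_ : ∀ {k} → DecidableEquality (Vec Bool k)
_≟ₕ_ = ≡-dec Bool._≟_

∑-allVecs : ∀ k (f : Vec Bool (suc k) → ℕ) →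
            ∑ (allVecs (suc k)) f ≡ ∑ (allVecs k) (λ v → f (false ∷ᵥ v) + f (true ∷ᵥ v))
∑-allVecs k f = go (allVecs k)
  where
  go : ∀ vs → ∑ (concatMap (λ v → (false ∷ᵥ v) ∷ (true ∷ᵥ v) ∷ []) vs) f
            ≡ ∑ vs (λ v → f (false ∷ᵥ v) + f (true ∷ᵥ v))
  go []       = refl
  go (v ∷ vs) rewrite go vs = sym (+-assoc (f (false ∷ᵥ v)) _ _)

∑-allVecs-1 : ∀ k → ∑ (allVecs k) (λ _ → 1) ≡ 2 ^ k
∑-allVecs-1 zero    = refl
∑-allVecs-1 (suc k) = begin
  ∑ (allVecs (suc k)) (λ _ → 1)         ≡⟨ ∑-allVecs k _ ⟩
  ∑ (allVecs k) (λ _ → 2)               ≡⟨ ∑-*ʳ (allVecs k) (λ _ → 1) 2 ⟩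
  ∑ (allVecs k) (λ _ → 1) * 2           ≡⟨ cong (_* 2) (∑-allVecs-1 k) ⟩
  2 ^ k * 2                             ≡⟨ *-comm (2 ^ k) 2 ⟩
  2 ^ suc k                             ∎
  where open ≡-Reasoning

length-allVecs : ∀ k → length (allVecs k) ≡ 2 ^ k
length-allVecs k =
  trans (sym (*-identityʳ _)) (trans (sym (∑-const (allVecs k) 1)) (∑-allVecs-1 k))

∈-allVecs : ∀ {k} (v : Vec Bool k) → v ∈ allVecs k
∈-allVecs []ᵥ = here refl
∈-allVecs (b ∷ᵥ v) = ∈-concatMap⁺ _ (Any.map (pick b) (∈-allVecs v))
  where
  pick : ∀ b {w} → v ≡ w → b ∷ᵥ v ∈ (false ∷ᵥ w) ∷ (true ∷ᵥ w) ∷ []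
  pick false refl = here refl
  pick true  refl = there (here refl)

∑-allVecs-once : ∀ k t → ∑ (allVecs k) (λ v → ⟦ v ≟ₕ t ⟧) ≤ 1
∑-allVecs-once zero    []ᵥ      = ≤-refl
∑-allVecs-once (suc k) (b ∷ᵥ t) = begin
  ∑ (allVecs (suc k)) (λ v → ⟦ v ≟ₕ b ∷ᵥ t ⟧)  ≡⟨ ∑-allVecs k _ ⟩
  ∑ (allVecs k) (λ v → ⟦ false ∷ᵥ v ≟ₕ b ∷ᵥ t ⟧ + ⟦ true ∷ᵥ v ≟ₕ b ∷ᵥ t ⟧) ≤⟨ ∑-mono (allVecs k) (λ v _ → one b v) ⟩
  ∑ (allVecs k) (λ v → ⟦ v ≟ₕ t ⟧)             ≤⟨ ∑-allVecs-once k t ⟩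
  1                                            ∎
  where
  open ≤-Reasoning
  one : ∀ b v → ⟦ false ∷ᵥ v ≟ₕ b ∷ᵥ t ⟧ + ⟦ true ∷ᵥ v ≟ₕ b ∷ᵥ t ⟧ ≤ ⟦ v ≟ₕ t ⟧
  one false v = ≤-reflexive (+-identityʳ _)
  one true  v = ≤-refl

∑-allVecs-bitₛ : ∀ k (i : Fin (suc k)) b → 2 ^ k ≤ ∑ (allVecs (suc k)) (λ v → ⟦ lookup v i Bool.≟ b ⟧)
∑-allVecs-bitₛ k zero b = begin
  2 ^ k                                                  ≡⟨ ∑-allVecs-1 k ⟨
  ∑ (allVecs k) (λ _ → 1)                                ≤⟨ ∑-mono (allVecs k) (λ _ _ → either b) ⟩
  ∑ (allVecs k) (λ v → ⟦ false Bool.≟ b ⟧ + ⟦ true Bool.≟ b ⟧) ≡⟨ ∑-allVecs k _ ⟨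
  ∑ (allVecs (suc k)) (λ v → ⟦ lookup v zero Bool.≟ b ⟧) ∎
  where
  open ≤-Reasoning
  either : ∀ b → 1 ≤ ⟦ false Bool.≟ b ⟧ + ⟦ true Bool.≟ b ⟧
  either false = ≤-refl
  either true  = ≤-refl
∑-allVecs-bitₛ (suc k) (suc i) b = begin
  2 ^ suc k                                   ≡⟨ *-comm 2 (2 ^ k) ⟩
  2 ^ k * 2                                   ≤⟨ *-monoˡ-≤ 2 (∑-allVecs-bitₛ k i b) ⟩
  ∑ (allVecs (suc k)) f * 2                   ≡⟨ ∑-*ʳ (allVecs (suc k)) f 2 ⟨
  ∑ (allVecs (suc k)) (λ v → f v * 2)         ≤⟨ ∑-mono (allVecs (suc k)) (λ v _ → ≤-reflexive (twice (f v))) ⟩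
  ∑ (allVecs (suc k)) (λ v → f v + f v)       ≡⟨ ∑-allVecs (suc k) _ ⟨
  ∑ (allVecs (suc (suc k))) (λ v → ⟦ lookup v (suc i) Bool.≟ b ⟧) ∎
  where
  open ≤-Reasoning
  f : Vec Bool (suc k) → ℕ
  f v = ⟦ lookup v i Bool.≟ b ⟧
  twice : ∀ a → a * 2 ≡ a + a
  twice = solve-∀

-- A literal is true in half of the holes; doubling the count avoids an exponent k - 1.
∑-allVecs-bit : ∀ k (i : Fin k) b → 2 ^ k ≤ 2 * ∑ (allVecs k) (λ v → ⟦ lookup v i Bool.≟ b ⟧)
∑-allVecs-bit (suc k) i b = *-monoʳ-≤ 2 (∑-allVecs-bitₛ k i b)

-- The memberships in `T`, summed over all holes, number at most `length T`, so some hole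
-- contributes 0.
fresh-hole : ∀ {k} (T : List (Vec Bool k)) → length T < 2 ^ k → ∃ λ h → h ∉ T
fresh-hole {k} T lt =
  let h , _ , e = ∑-zero (allVecs k) (λ h → ⟦ h ∈ₕ? T ⟧)
        (≤-<-trans (Membership.∑-∈≤length _≟ₕ_ (allVecs k) (∑-allVecs-once k) T)
                   (subst (length T <_) (sym (length-allVecs k)) lt))
  in h , ⟦no⟧ (h ∈ₕ? T) e
  where open import Data.List.Membership.DecPropositional (_≟ₕ_ {k}) using () renaming (_∈?_ to _∈ₕ?_)

∈-concatMap⁻′ : ∀ {A B : Set} (f : A → List B) {xs y} → y ∈ concatMap f xs →
                ∃ λ x → x ∈ xs × y ∈ f x
∈-concatMap⁻′ f i = find (∈-concatMap⁻ f i)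

∈-concatMap⁺′ : ∀ {A B : Set} (f : A → List B) {xs y x} → x ∈ xs → y ∈ f x →
                y ∈ concatMap f xs
∈-concatMap⁺′ f i j = ∈-concatMap⁺ f (lose i j)

-- Literals, and the clauses of BPHP and `𝒢`.

negate-negate : ∀ l → negate (negate l) ≡ l
negate-negate (pos _) = refl
negate-negate (neg _) = refl

var-negate : ∀ l → var (negate l) ≡ var l
var-negate (pos _) = refl
var-negate (neg _) = refl

negate≢ : ∀ l → negate l ≢ l
negate≢ (pos _) ()
negate≢ (neg _) ()

compl⇒Taut : ∀ {C} l → l ∈ C → negate l ∈ C → Taut C
compl⇒Taut (pos v) i j = v , i , j
compl⇒Taut (neg v) i j = v , j , i

-- Every variable v is read as bit v mod k of pigeon v / k; the extension
-- variables thus belong to phantom pigeons, those from suc (2 ^ k) on.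
module Bits (k : ℕ) .{{_ : NonZero k}} where

  Hole : Set
  Hole = Vec Bool k

  pigeon : Lit → ℕ
  pigeon l = var l / k

  litVal : Hole → Lit → Bool
  litVal h (pos v) = lookup h (v mod k)
  litVal h (neg v) = not (lookup h (v mod k))

  M : ℕ
  M = suc (2 ^ k)

  litVal-negate : ∀ h l → litVal h (negate l) ≡ not (litVal h l)
  litVal-negate h (pos v) = refl
  litVal-negate h (neg v) with lookup h (v mod k)
  ... | true  = refl
  ... | false = refl

  pigeon-negate : ∀ l → pigeon (negate l) ≡ pigeon l
  pigeon-negate l = cong (_/ k) (var-negate l)

  pvar-/ : ∀ x ℓ → pvar k x ℓ / k ≡ x
  pvar-/ x ℓ = begin
    (x * k + toℕ ℓ) / k     ≡⟨ +-distrib-/-∣ˡ (toℕ ℓ) (divides-refl x) ⟩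
    x * k / k + toℕ ℓ / k   ≡⟨ cong₂ _+_ (m*n/n≡m x k) (m<n⇒m/n≡0 (toℕ<n ℓ)) ⟩
    x + 0                   ≡⟨ +-identityʳ x ⟩
    x                       ∎
    where open ≡-Reasoning

  pvar-mod : ∀ x ℓ → pvar k x ℓ mod k ≡ ℓ
  pvar-mod x ℓ = toℕ-injective (begin
    toℕ (pvar k x ℓ mod k)  ≡⟨ toℕ-fromℕ< _ ⟩
    (x * k + toℕ ℓ) % k     ≡⟨ cong (_% k) (+-comm (x * k) (toℕ ℓ)) ⟩
    (toℕ ℓ + x * k) % k     ≡⟨ [m+kn]%n≡m%n (toℕ ℓ) x k ⟩
    toℕ ℓ % k               ≡⟨ m<n⇒m%n≡m (toℕ<n ℓ) ⟩
    toℕ ℓ                   ∎)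
    where open ≡-Reasoning

  pvar-/-mod : ∀ v → v ≡ pvar k (v / k) (v mod k)
  pvar-/-mod v = begin
    v                             ≡⟨ m≡m%n+[m/n]*n v k ⟩
    v % k + v / k * k             ≡⟨ +-comm (v % k) _ ⟩
    v / k * k + v % k             ≡⟨ cong (v / k * k +_) (toℕ-fromℕ< (m%n<n v k)) ⟨
    pvar k (v / k) (v mod k)      ∎
    where open ≡-Reasoning

  notAt : ℕ → Hole → Clause
  notAt x h = map (λ ℓ → neqLit (pvar k x ℓ) (lookup h ℓ)) (allFin k)

  ∈-notAt⁻ : ∀ {x h l} → l ∈ notAt x h → pigeon l ≡ x × litVal h l ≡ false
  ∈-notAt⁻ {x} {h} i with ∈-map⁻ _ i
  ... | ℓ , _ , refl = pigeon-neqLit (lookup h ℓ) , val-neqLit (lookup h ℓ) refl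
    where
    pigeon-neqLit : ∀ b → pigeon (neqLit (pvar k x ℓ) b) ≡ x
    pigeon-neqLit true  = pvar-/ x ℓ
    pigeon-neqLit false = pvar-/ x ℓ
    val-neqLit : ∀ b → lookup h ℓ ≡ b → litVal h (neqLit (pvar k x ℓ) b) ≡ false
    val-neqLit true  e rewrite pvar-mod x ℓ | e = refl
    val-neqLit false e rewrite pvar-mod x ℓ | e = refl

  ∈-notAt⁺ : ∀ {x h} l → pigeon l ≡ x → litVal h l ≡ false → l ∈ notAt x h
  ∈-notAt⁺ {x} {h} l refl e = subst (_∈ notAt x h) (sym (isNeqLit l e)) (∈-map⁺ _ (∈-allFin _))
    where
    isNeqLit : ∀ l → litVal h l ≡ false →
               l ≡ neqLit (pvar k (pigeon l) (var l mod k)) (lookup h (var l mod k))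
    isNeqLit (pos v) e rewrite e = cong pos (pvar-/-mod v)
    isNeqLit (neg v) e with lookup h (v mod k)
    ... | true = cong neg (pvar-/-mod v)

  ∈-bphpPow⁻ : ∀ {C} → C ∈ bphpPow k → Σ ℕ λ x → Σ ℕ λ y → Σ Hole λ h →
               x < M × y < M × x ≢ y × C ≡ notAt x h ++ notAt y h
  ∈-bphpPow⁻ i with ∈-concatMap⁻′ _ i
  ... | x , x∈ , i₁ with ∈-concatMap⁻′ _ i₁
  ... | y , y∈ , i₂ with inner (x ≡ᵇ y) i₂
    where
    inner : ∀ b {C} → C ∈ (if b then [] else map (bphpClause k x y) (allVecs k)) →
            b ≡ false × Σ Hole λ h → C ≡ notAt x h ++ notAt y h
    inner false j with ∈-map⁻ (bphpClause k x y) j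
    ... | h , _ , e = refl , h , e
  ... | eq , h , e = x , y , h , ∈-upTo⁻ x∈ , ∈-upTo⁻ y∈ ,
        (λ x≡y → subst Bool.T eq (≡⇒≡ᵇ x y x≡y)) , e

  ∈-bphpPow⁺ : ∀ {x y} h → x < M → y < M → x ≢ y → notAt x h ++ notAt y h ∈ bphpPow k
  ∈-bphpPow⁺ {x} {y} h x< y< x≢y =
    ∈-concatMap⁺′ _ (∈-upTo⁺ x<) (∈-concatMap⁺′ _ (∈-upTo⁺ y<) inner)
    where
    inner : notAt x h ++ notAt y h ∈ (if x ≡ᵇ y then [] else map (bphpClause k x y) (allVecs k))
    inner with x ≡ᵇ y in eq
    ... | true  = ⊥-elim (x≢y (≡ᵇ⇒≡ x y (subst Bool.T (sym eq) _)))
    ... | false = ∈-map⁺ (bphpClause k x y) (∈-allVecs h)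

  ∈-bphp-pigeon : ∀ {C l} → C ∈ bphpPow k → l ∈ C → pigeon l < M
  ∈-bphp-pigeon i j with ∈-bphpPow⁻ i
  ... | x , y , h , x< , y< , _ , refl with ∈-++⁻ (notAt x h) j
  ... | inj₁ j₁ = subst (_< M) (sym (proj₁ (∈-notAt⁻ {x} {h} j₁))) x<
  ... | inj₂ j₂ = subst (_< M) (sym (proj₁ (∈-notAt⁻ {y} {h} j₂))) y<

∈-orLit⁻ : ∀ {l Γ D} → D ∈ orLit l Γ → ∃ λ D₀ → D₀ ∈ Γ × D ≡ l ∷ D₀
∈-orLit⁻ {l} i with ∈-map⁻ (l ∷_) i
... | D₀ , j , refl = D₀ , proj₁ (∈-filter⁻ (λ D → ¬? (negate l ∈? D)) j) , refl

∈-orLit⁺ : ∀ {l Γ D} → D ∈ Γ → negate l ∉ D → l ∷ D ∈ orLit l Γ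
∈-orLit⁺ {l} i n = ∈-map⁺ (l ∷_) (∈-filter⁺ (λ D → ¬? (negate l ∈? D)) i n)

module _ {Γ : Formula} (π : ERProof Γ) where
  open ERProof π

  ∈-𝒢⁻ : ∀ {D} → D ∈ 𝒢 Γ π → D ∈ Γ ⊎
         (Σ ExtTriple λ e → e ∈ exts × Σ Lit λ l → var l ≡ proj₁ e × Σ Clause λ D₀ → D₀ ∈ Γ × D ≡ l ∷ D₀)
  ∈-𝒢⁻ i with ∈-++⁻ Γ i
  ... | inj₁ j = inj₁ j
  ... | inj₂ j with ∈-concatMap⁻′ {A = ExtTriple} _ {exts} j
  ... | e@(x , _) , e∈ , j₁ with ∈-++⁻ (orLit (pos x) Γ) j₁
  ... | inj₁ a = inj₂ (e , e∈ , pos x , refl , ∈-orLit⁻ a)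
  ... | inj₂ a = inj₂ (e , e∈ , neg x , refl , ∈-orLit⁻ a)

  ∈-𝒢⁺ : ∀ {D} → D ∈ Γ → D ∈ 𝒢 Γ π
  ∈-𝒢⁺ = ∈-++⁺ˡ

  ∈-𝒢-ext⁺ : ∀ {D e} l → e ∈ exts → var l ≡ proj₁ e → D ∈ Γ → negate l ∉ D → l ∷ D ∈ 𝒢 Γ π
  ∈-𝒢-ext⁺ {D} {e} l e∈ v D∈ n = ∈-++⁺ʳ Γ (∈-concatMap⁺′ _ e∈ (pick l v n))
    where
    x = proj₁ e
    pick : ∀ l → var l ≡ x → negate l ∉ D → l ∷ D ∈ orLit (pos x) Γ ++ orLit (neg x) Γ
    pick (pos _) refl n = ∈-++⁺ˡ (∈-orLit⁺ D∈ n)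
    pick (neg _) refl n = ∈-++⁺ʳ (orLit (pos x) Γ) (∈-orLit⁺ D∈ n)

-- Set-blocked clauses mention all pigeons but one.

module Wide (k : ℕ) .{{_ : NonZero k}} (π : ERProof (bphpPow k)) where
  open Bits k
  open ERProof π using (exts)

  G : Formula
  G = 𝒢 (bphpPow k) π

  Mentions : Clause → ℕ → Set
  Mentions C x = Any (λ l → pigeon l ≡ x) C

  mentions? : ∀ C x → Dec (Mentions C x)
  mentions? C x = any? (λ l → pigeon l ≟ x) C

  mentioned : ∀ {C l x} → l ∈ C → pigeon l ≡ x → Mentions C x
  mentioned i e = lose i e

  module _ {C : Clause} (C-clause : IsClause C) (L : List Lit) (L⊆C : ∀ l → l ∈ L → l ∈ C) (x : ℕ) where

    -- On pigeon `x`, literals of `L` are made true and those of C ∖ L false; variables that C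
    -- leaves open default to false. The demands are consistent because C is not tautological.
    setsTrue : ℕ → Bool
    setsTrue v = does (pos v ∈? L) ∨ (does (neg v ∈? C) ∧ not (does (neg v ∈? L)))

    hole : Hole
    hole = tabulate (λ ℓ → setsTrue (pvar k x ℓ))

    lookup-hole : ∀ v → v / k ≡ x → lookup hole (v mod k) ≡ setsTrue v
    lookup-hole v refl = trans (lookup∘tabulate _ (v mod k)) (cong setsTrue (sym (pvar-/-mod v)))

    hole-L : ∀ l → l ∈ L → pigeon l ≡ x → litVal hole l ≡ true
    hole-L (pos v) i e rewrite lookup-hole v e | dec-true (pos v ∈? L) i = refl
    hole-L (neg v) i e
      rewrite lookup-hole v e
            | dec-false (pos v ∈? L) (λ j → C-clause (v , L⊆C _ j , L⊆C _ i))
            | dec-true (neg v ∈? C) (L⊆C _ i) | dec-true (neg v ∈? L) i = refl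

    hole-C : ∀ l → l ∈ C → l ∉ L → pigeon l ≡ x → litVal hole l ≡ false
    hole-C (pos v) i n e
      rewrite lookup-hole v e | dec-false (pos v ∈? L) n
            | dec-false (neg v ∈? C) (λ j → C-clause (v , i , j)) = refl
    hole-C (neg v) i n e with pos v ∈? L in eq
    ... | yes j = ⊥-elim (C-clause (v , L⊆C _ j , i))
    ... | no m
      rewrite lookup-hole v e | dec-false (pos v ∈? L) m
            | dec-true (neg v ∈? C) i | dec-false (neg v ∈? L) n = refl

    -- Seat both x and y in `hole`. This falsifies every literal of D outside the negated `L`, and
    -- every literal of C ∖ L on x. C has no literal on y, and D has none on further pigeons except
    -- in the negated `L`, so no complementary pair can arise. The alternative `negate d ∈ L` in the
    -- shape of D admits the leading literal of a clause from x ∨ Γ or x̄ ∨ Γ.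
    not-blocked : ∀ {y} → ¬ Mentions C y → (D : Clause) →
      (∀ d → d ∈ D → (d ∈ notAt x hole ⊎ d ∈ notAt y hole) ⊎ negate d ∈ L) →
      (∀ l → l ∈ L → l ∉ D) × ¬ (Σ ℕ λ v →
        let In = λ l → (l ∈ C × l ∉ L) ⊎ (l ∈ D × negate l ∉ L) in In (pos v) × In (neg v))
    not-blocked {y} y∉C D D-shape = disjoint , λ { (v , a , b) → clash (pos v) a b }
      where
      In : Lit → Set
      In l = (l ∈ C × l ∉ L) ⊎ (l ∈ D × negate l ∉ L)

      disjoint : ∀ l → l ∈ L → l ∉ D
      disjoint l i j with D-shape l j
      ... | inj₂ c = C-clause (compl⇒Taut l (L⊆C _ i) (L⊆C _ c))
      ... | inj₁ (inj₂ c) = y∉C (mentioned (L⊆C _ i) (proj₁ (∈-notAt⁻ {y} {hole} c)))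
      ... | inj₁ (inj₁ c) with ∈-notAt⁻ {x} {hole} c
      ...   | e , f with trans (sym f) (hole-L l i e)
      ...   | ()

      C-D : ∀ a → a ∈ C → a ∉ L → negate a ∈ D → ⊥
      C-D a i n j with D-shape (negate a) j
      ... | inj₂ c = n (subst (_∈ L) (negate-negate a) c)
      ... | inj₁ (inj₂ c) =
            y∉C (mentioned i (trans (sym (pigeon-negate a)) (proj₁ (∈-notAt⁻ {y} {hole} c))))
      ... | inj₁ (inj₁ c) with ∈-notAt⁻ {x} {hole} c
      ...   | e , f with trans (sym f) (trans (litVal-negate hole a)
                        (cong not (hole-C a i n (trans (sym (pigeon-negate a)) e))))
      ...   | ()

      D-false : ∀ a → a ∈ D → negate a ∉ L → litVal hole a ≡ false
      D-false a i n with D-shape a i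
      ... | inj₂ c = ⊥-elim (n c)
      ... | inj₁ (inj₁ c) = proj₂ (∈-notAt⁻ {x} {hole} c)
      ... | inj₁ (inj₂ c) = proj₂ (∈-notAt⁻ {y} {hole} c)

      clash : ∀ a → In a → In (negate a) → ⊥
      clash a (inj₁ (i , _)) (inj₁ (j , _)) = C-clause (compl⇒Taut a i j)
      clash a (inj₁ (i , n)) (inj₂ (j , _)) = C-D a i n j
      clash a (inj₂ (i , _)) (inj₁ (j , n)) =
        C-D (negate a) j n (subst (_∈ D) (sym (negate-negate a)) i)
      clash a (inj₂ (i , n)) (inj₂ (j , m))
        with trans (sym (D-false (negate a) j m))
                   (trans (litVal-negate hole a) (cong not (D-false a i n)))
      ... | ()

  -- The restriction to variables of `G` enters here: one that is not a BPHP variable is an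
  -- extension variable of `π`, so `G` contains weakenings of BPHP clauses by either of its
  -- literals.
  extension-of-phantom : ∀ {l} → Occurs (var l) G → ¬ (pigeon l < M) →
                         ∃ λ e → e ∈ exts × var l ≡ proj₁ e
  extension-of-phantom {l} (D , D∈ , l₁ , l₁∈ , v) ph with ∈-𝒢⁻ π D∈
  ... | inj₁ i = ⊥-elim (ph (subst (λ u → u / k < M) v (∈-bphp-pigeon i l₁∈)))
  ... | inj₂ (e , e∈ , l₂ , v₂ , D₀ , D₀∈ , refl) with l₁∈
  ...   | here refl = e , e∈ , trans (sym v) v₂
  ...   | there j = ⊥-elim (ph (subst (λ u → u / k < M) v (∈-bphp-pigeon D₀∈ j)))

  -- If C leaves pigeon y ≠ x unmentioned, the negation of C ∖ L together with L is
  -- consistent with x and y sharing a hole, so a clause of G is not blocked.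
  sbc-wide : ∀ {Γ C} → (∀ D → D ∈ G → D ∈ Γ) → (∀ l → l ∈ C → Occurs (var l) G) → SBC Γ C →
             ∃ λ x → ∀ y → y < M → y ≢ x → Mentions C y
  sbc-wide {Γ} {C} G⊆Γ occ (C-clause , [] , L≢[] , _) = ⊥-elim (L≢[] refl)
  sbc-wide {Γ} {C} G⊆Γ occ (C-clause , L@(l₀ ∷ _) , _ , L⊆C , blocked)
    with any? (λ l → pigeon l <? M) L
  ... | yes p with find p
  ...   | l , l∈L , l<M = x , wide
    where
    x = pigeon l
    h = hole C-clause L L⊆C x
    wide : ∀ y → y < M → y ≢ x → Mentions C y
    wide y y<M y≢x with mentions? C y
    ... | yes m = m
    ... | no ¬m = ⊥-elim (proj₂ nb (blocked D D∈Γ (l , l∈L , l̄∈D) (proj₁ nb)))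
      where
      D = notAt x h ++ notAt y h
      D∈Γ : D ∈ Γ
      D∈Γ = G⊆Γ D (∈-𝒢⁺ π (∈-bphpPow⁺ h l<M y<M (λ e → y≢x (sym e))))
      l̄∈D : negate l ∈ D
      l̄∈D = ∈-++⁺ˡ (∈-notAt⁺ {x} {h} (negate l) (pigeon-negate l)
             (trans (litVal-negate h l) (cong not (hole-L C-clause L L⊆C x l l∈L refl))))
      nb = not-blocked C-clause L L⊆C x ¬m D (λ d i → inj₁ (∈-++⁻ (notAt x h) i))
  -- Now `L` concerns phantom pigeons only and meets no BPHP clause. A BPHP clause weakened by the
  -- negation of `l₀` takes over; pigeon 0 is an arbitrary choice of real pigeon.
  sbc-wide {Γ} {C} G⊆Γ occ (C-clause , L@(l₀ ∷ _) , _ , L⊆C , blocked)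
      | no ¬p = 0 , wide
    where
    h = hole C-clause L L⊆C 0
    phantom : ¬ (pigeon l₀ < M)
    phantom q = ¬p (lose (here refl) q)
    wide : ∀ y → y < M → y ≢ 0 → Mentions C y
    wide y y<M y≢0 with mentions? C y
    ... | yes m = m
    ... | no ¬m = ⊥-elim (proj₂ nb (blocked D D∈Γ (l₀ , here refl , here refl) (proj₁ nb)))
      where
      D₀ = notAt 0 h ++ notAt y h
      D = negate l₀ ∷ D₀
      D₀∈ : D₀ ∈ bphpPow k
      D₀∈ = ∈-bphpPow⁺ h (s≤s z≤n) y<M (λ e → y≢0 (sym e))
      D∈Γ : D ∈ Γ
      D∈Γ with extension-of-phantom {l₀} (occ l₀ (L⊆C l₀ (here refl))) phantom
      ... | e , e∈ , v = G⊆Γ D (∈-𝒢-ext⁺ π (negate l₀) e∈ (trans (var-negate l₀) v) D₀∈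
            (λ i → phantom (∈-bphp-pigeon D₀∈ (subst (_∈ D₀) (negate-negate l₀) i))))
      shape : ∀ d → d ∈ D → (d ∈ notAt 0 h ⊎ d ∈ notAt y h) ⊎ negate d ∈ L
      shape d (here refl) = inj₂ (subst (_∈ L) (sym (negate-negate l₀)) (here refl))
      shape d (there i)   = inj₁ (∈-++⁻ (notAt 0 h) i)
      nb = not-blocked C-clause L L⊆C 0 ¬m D shape

-- Greedy choice of a partial matching.

added : ∀ {R Γ N} → Proof R Γ N → List Clause
added (done _)            = []
added (add {C = C} _ p)   = C ∷ added p

length-added : ∀ {R Γ N} (p : Proof R Γ N) → suc (length (added p)) ≡ N
length-added (done _)  = refl
length-added (add _ p) = cong suc (length-added p)

update : {A : Set} → (ℕ → A) → ℕ → A → ℕ → A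
update α x h z with z ≟ x
... | yes _ = h
... | no _  = α z

update-≡ : ∀ {A : Set} (α : ℕ → A) x h → update α x h x ≡ h
update-≡ α x h with x ≟ x
... | yes _ = refl
... | no n  = ⊥-elim (n refl)

update-≢ : ∀ {A : Set} (α : ℕ → A) x h {z} → z ≢ x → update α x h z ≡ α z
update-≢ α x h {z} n with z ≟ x
... | yes e = ⊥-elim (n e)
... | no _  = refl

module Lower (k : ℕ) .{{_ : NonZero k}} (π : ERProof (bphpPow k)) (q : ℕ) (4q : 4 * q ≡ 2 ^ k) where
  open Bits k
  open Wide k π
  open import Data.List.Membership.DecPropositional _≟_ using () renaming (_∈?_ to _∈ₙ?_)
  open import Data.List.Membership.DecPropositional (_≟ₕ_ {k}) using () renaming (_∈?_ to _∈ₕ?_)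

  InjectiveOn : (ℕ → Set) → (ℕ → Hole) → Set
  InjectiveOn P α = ∀ {x y} → P x → P y → α x ≡ α y → x ≡ y

  -- Serves both the greedy choice and the seating of a pivot's pigeon. `avoid` exempts `x`, whose
  -- old seat is overwritten.
  InjectiveOn-update : ∀ {P α x h} → InjectiveOn P α → (∀ y → P y → y ≢ x → α y ≢ h) →
                       InjectiveOn (λ z → z ≡ x ⊎ P z) (update α x h)
  InjectiveOn-update {P} {α} {x} {h} inj avoid {y} {z} py pz e with y ≟ x | z ≟ x
  ... | yes refl | yes refl = refl
  ... | yes refl | no z≢x with pz
  ...   | inj₁ z≡x = ⊥-elim (z≢x z≡x)
  ...   | inj₂ p   = ⊥-elim (avoid z p z≢x (sym e))
  InjectiveOn-update inj avoid {y} {z} py pz e | no y≢x | yes refl with py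
  ...   | inj₁ y≡x = ⊥-elim (y≢x y≡x)
  ...   | inj₂ p   = ⊥-elim (avoid y p y≢x e)
  InjectiveOn-update inj avoid {y} {z} py pz e | no y≢x | no z≢x with py | pz
  ... | inj₁ y≡x | _ = ⊥-elim (y≢x y≡x)
  ... | inj₂ _ | inj₁ z≡x = ⊥-elim (z≢x z≡x)
  ... | inj₂ p | inj₂ p₁ = inj p p₁ e

  -- A partial matching with domain `S`; `α` is total for convenience, and only its values on `S`
  -- count.
  record Restriction : Set where
    field
      α   : ℕ → Hole
      S   : List ℕ
      inj : InjectiveOn (_∈ S) α

  Sat : Hole → Clause → ℕ → Set
  Sat h C x = Any (λ l → pigeon l ≡ x × litVal h l ≡ true) C

  sat? : ∀ h C x → Dec (Sat h C x)
  sat? h C x = any? (λ l → (pigeon l ≟ x) ×-dec (litVal h l Bool.≟ true)) C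

  Killed : Restriction → Clause → Set
  Killed ρ C = ∃ λ x → x ∈ S × Sat (α x) C x
    where open Restriction ρ

  width : Clause → ℕ
  width C = ∑ (upTo M) (λ x → ⟦ mentions? C x ⟧)

  -- All but one of the 4q + 1 pigeons are mentioned, well above the threshold 2q between narrow and
  -- wide.
  wide-count : ∀ {C x} → (∀ y → y < M → y ≢ x → Mentions C y) → 2 * q ≤ width C
  wide-count {C} {x} h = begin
    2 * q                                    ≤⟨ *-monoˡ-≤ q {2} {4} (s≤s (s≤s z≤n)) ⟩
    4 * q                                    ≡⟨ 4q ⟩
    2 ^ k                                    ≤⟨ s≤s⁻¹ total ⟩
    width C                                  ∎
    where
    open ≤-Reasoning
    present : ∀ y → y ∈ upTo M → 1 ≤ ⟦ mentions? C y ⟧ + ⟦ y ≟ x ⟧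
    present y y∈ = ⟦⟧-either (mentions? C y) (y ≟ x) (decide (y ≟ x))
      where
      decide : Dec (y ≡ x) → Mentions C y ⊎ y ≡ x
      decide (yes e) = inj₂ e
      decide (no n)  = inj₁ (h y (∈-upTo⁻ y∈) n)
    total : M ≤ suc (width C)
    total = begin
      M                                                   ≡⟨ length-upTo M ⟨
      length (upTo M)                                     ≡⟨ *-identityʳ _ ⟨
      length (upTo M) * 1                                 ≡⟨ ∑-const (upTo M) 1 ⟨
      ∑ (upTo M) (λ _ → 1)                                ≤⟨ ∑-mono (upTo M) present ⟩
      ∑ (upTo M) (λ y → ⟦ mentions? C y ⟧ + ⟦ y ≟ x ⟧)    ≡⟨ ∑-+ (upTo M) (λ y → ⟦ mentions? C y ⟧) (λ y → ⟦ y ≟ x ⟧) ⟩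
      width C + ∑ (upTo M) (λ y → ⟦ y ≟ x ⟧)              ≤⟨ +-monoʳ-≤ (width C) (∑-upTo-once M x) ⟩
      width C + 1                                         ≡⟨ +-comm (width C) 1 ⟩
      suc (width C)                                       ∎

  module _ (ρ : Restriction) where
    open Restriction ρ

    private
      T : List Hole
      T = map α S

    Kills : Clause → ℕ → Hole → Set
    Kills C x h = x ∉ S × h ∉ T × Sat h C x

    kills? : ∀ C x h → Dec (Kills C x h)
    kills? C x h = ¬? (x ∈ₙ? S) ×-dec ¬? (h ∈ₕ? T) ×-dec sat? h C x

    module _ (|S|≤q : length S ≤ q) where
      |T|≤q : length T ≤ q
      |T|≤q = ≤-trans (≤-reflexive (length-map α S)) |S|≤q

      -- One literal of `C` on `x` is true in half of the holes, that is in 2q of them, and the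
      -- matching has taken at most q.
      killing-holes : ∀ {C x} → x ∉ S → Mentions C x → q ≤ ∑ (allVecs k) (λ h → ⟦ kills? C x h ⟧)
      killing-holes {C} {x} x∉S m with find m
      ... | l , l∈C , refl = +-cancelʳ-≤ q q _ (*-cancelˡ-≤ 2 (begin
        2 * (q + q)                                               ≡⟨ quadruple q ⟩
        4 * q                                                     ≡⟨ 4q ⟩
        2 ^ k                                                     ≤⟨ ∑-allVecs-bit k (var l mod k) (sign l) ⟩
        2 * ∑ (allVecs k) (λ h → ⟦ lookup h (var l mod k) Bool.≟ sign l ⟧)
          ≤⟨ *-monoʳ-≤ 2 (∑-mono (allVecs k) (λ h _ → ⟦⟧-cover (lookup h (var l mod k) Bool.≟ sign l) (kills? C x h) (h ∈ₕ? T) (split h))) ⟩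
        2 * ∑ (allVecs k) (λ h → ⟦ kills? C x h ⟧ + ⟦ h ∈ₕ? T ⟧)  ≡⟨ cong (2 *_) (∑-+ (allVecs k) _ _) ⟩
        2 * (∑ (allVecs k) (λ h → ⟦ kills? C x h ⟧) + ∑ (allVecs k) (λ h → ⟦ h ∈ₕ? T ⟧))
          ≤⟨ *-monoʳ-≤ 2 (+-monoʳ-≤ (∑ (allVecs k) (λ h → ⟦ kills? C x h ⟧))
               (≤-trans (Membership.∑-∈≤length _≟ₕ_ (allVecs k) (∑-allVecs-once k) T) |T|≤q)) ⟩
        2 * (∑ (allVecs k) (λ h → ⟦ kills? C x h ⟧) + q)          ∎))
        where
        open ≤-Reasoning
        quadruple : ∀ a → 2 * (a + a) ≡ 4 * a
        quadruple = solve-∀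
        sign : Lit → Bool
        sign (pos _) = true
        sign (neg _) = false
        sign-true : ∀ l h → lookup h (var l mod k) ≡ sign l → litVal h l ≡ true
        sign-true (pos _) h e = e
        sign-true (neg _) h e = cong not e
        split : ∀ h → lookup h (var l mod k) ≡ sign l → Kills C x h ⊎ h ∈ T
        split h e with h ∈ₕ? T
        ... | yes i = inj₂ i
        ... | no  n = inj₁ (x∉S , n , lose l∈C (refl , sign-true l h e))

      -- Of the 2q mentioned pigeons at most q are matched; each of the others has q killing holes.
      killing-pairs : ∀ {C} → 2 * q ≤ width C →
                      q * q ≤ ∑ (upTo M) (λ x → ∑ (allVecs k) (λ h → ⟦ kills? C x h ⟧))
      killing-pairs {C} w = begin
        q * q                                   ≤⟨ *-monoˡ-≤ q free-mentioned ⟩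
        ∑ (upTo M) (λ x → ⟦ fm? x ⟧) * q        ≡⟨ ∑-*ʳ (upTo M) (λ x → ⟦ fm? x ⟧) q ⟨
        ∑ (upTo M) (λ x → ⟦ fm? x ⟧ * q)        ≤⟨ ∑-mono (upTo M) (λ x _ → each x) ⟩
        ∑ (upTo M) (λ x → ∑ (allVecs k) (λ h → ⟦ kills? C x h ⟧)) ∎
        where
        open ≤-Reasoning
        fm? : ∀ x → Dec (x ∉ S × Mentions C x)
        fm? x = ¬? (x ∈ₙ? S) ×-dec mentions? C x
        each : ∀ x → ⟦ fm? x ⟧ * q ≤ ∑ (allVecs k) (λ h → ⟦ kills? C x h ⟧)
        each x = by (fm? x)
          where
          by : (d : Dec (x ∉ S × Mentions C x)) → ⟦ d ⟧ * q ≤ ∑ (allVecs k) (λ h → ⟦ kills? C x h ⟧)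
          by (yes (n , m)) = ≤-trans (≤-reflexive (*-identityˡ q)) (killing-holes n m)
          by (no _)        = z≤n
        split : ∀ x → Mentions C x → (x ∉ S × Mentions C x) ⊎ x ∈ S
        split x m with x ∈ₙ? S
        ... | yes i = inj₂ i
        ... | no  n = inj₁ (n , m)
        free-mentioned : q ≤ ∑ (upTo M) (λ x → ⟦ fm? x ⟧)
        free-mentioned = +-cancelʳ-≤ q q _ (begin
          q + q                                                  ≡⟨ cong (q +_) (+-identityʳ q) ⟨
          2 * q                                                  ≤⟨ w ⟩
          width C                                                ≤⟨ ∑-mono (upTo M) (λ x _ → ⟦⟧-cover (mentions? C x) (fm? x) (x ∈ₙ? S) (split x)) ⟩
          ∑ (upTo M) (λ x → ⟦ fm? x ⟧ + ⟦ x ∈ₙ? S ⟧)             ≡⟨ ∑-+ (upTo M) (λ x → ⟦ fm? x ⟧) (λ x → ⟦ x ∈ₙ? S ⟧) ⟩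
          ∑ (upTo M) (λ x → ⟦ fm? x ⟧) + ∑ (upTo M) (λ x → ⟦ x ∈ₙ? S ⟧)
            ≤⟨ +-monoʳ-≤ (∑ (upTo M) (λ x → ⟦ fm? x ⟧)) (≤-trans (Membership.∑-∈≤length _≟_ (upTo M) (∑-upTo-once M) S) |S|≤q) ⟩
          ∑ (upTo M) (λ x → ⟦ fm? x ⟧) + q                       ∎)

      -- Double counting: each wide clause has q² killing pairs among (4q + 1) · 4q ≤ 32q² pairs in
      -- all. Averaging over pigeons and then over holes finds one pair that kills a fraction 1/32
      -- of `W`.
      killing-pair : 1 ≤ q → ∀ W → (∀ C → C ∈ W → 2 * q ≤ width C) →
                     ∃ λ x → ∃ λ h → length W ≤ 32 * ∑ W (λ C → ⟦ kills? C x h ⟧)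
      killing-pair 1≤q W wide with ∑-average {xs = upTo M} (here refl) (λ x → ∑ (allVecs k) (λ h → ∑ W (λ C → ⟦ kills? C x h ⟧)))
      -- `α 0` only shows that the list of holes is inhabited.
      ... | x , _ , x-avg with ∑-average (∈-allVecs (α 0)) (λ h → ∑ W (λ C → ⟦ kills? C x h ⟧))
      ... | h , _ , h-avg = x , h , *-cancelˡ-≤ (q * q) {{>-nonZero (*-mono-≤ 1≤q 1≤q)}} (begin
        q * q * length W                                         ≡⟨ *-comm (q * q) _ ⟩
        length W * (q * q)                                       ≡⟨ ∑-const W (q * q) ⟨
        ∑ W (λ _ → q * q)                                        ≤⟨ ∑-mono W (λ C C∈ → killing-pairs {C} (wide C C∈)) ⟩
        ∑ W (λ C → ∑ (upTo M) (λ x → ∑ (allVecs k) (λ h → ⟦ kills? C x h ⟧)))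
          ≡⟨ ∑-swap W (upTo M) _ ⟩
        ∑ (upTo M) (λ x → ∑ W (λ C → ∑ (allVecs k) (λ h → ⟦ kills? C x h ⟧)))
          ≤⟨ ∑-mono (upTo M) (λ x _ → ≤-reflexive (∑-swap W (allVecs k) _)) ⟩
        ∑ (upTo M) (λ x → ∑ (allVecs k) (λ h → ∑ W (λ C → ⟦ kills? C x h ⟧)))
          ≤⟨ x-avg ⟩
        length (upTo M) * ∑ (allVecs k) (λ h → ∑ W (λ C → ⟦ kills? C x h ⟧))
          ≤⟨ *-monoʳ-≤ (length (upTo M)) h-avg ⟩
        length (upTo M) * (length (allVecs k) * f)
          ≡⟨ cong₂ (λ a b → a * (b * f)) (length-upTo M) (trans (length-allVecs k) (sym 4q)) ⟩
        suc (2 ^ k) * (4 * q * f)                                ≤⟨ *-monoˡ-≤ (4 * q * f) M≤8q ⟩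
        8 * q * (4 * q * f)                                      ≡⟨ regroup q f ⟩
        q * q * (32 * f)                                         ∎)
        where
        open ≤-Reasoning
        f = ∑ W (λ C → ⟦ kills? C x h ⟧)
        regroup : ∀ a b → 8 * a * (4 * a * b) ≡ a * a * (32 * b)
        regroup = solve-∀
        split8 : ∀ a → 4 * a + 4 * a ≡ 8 * a
        split8 = solve-∀
        M≤8q : suc (2 ^ k) ≤ 8 * q
        M≤8q = begin
          1 + 2 ^ k        ≡⟨ cong suc 4q ⟨
          1 + 4 * q        ≤⟨ +-monoˡ-≤ (4 * q) (≤-trans 1≤q (m≤m+n q _)) ⟩
          4 * q + 4 * q    ≡⟨ split8 q ⟩
          8 * q            ∎

  record Step (ρ : Restriction) (W : List Clause) : Set where
    field
      ρ′     : Restriction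
      size   : length (Restriction.S ρ′) ≤ suc (length (Restriction.S ρ))
      W′     : List Clause
      W′⊆W   : ∀ {C} → C ∈ W′ → C ∈ W
      split  : ∀ {C} → C ∈ W → Killed ρ′ C ⊎ C ∈ W′
      keep   : ∀ {C} → Killed ρ C → Killed ρ′ C
      shrink : 32 * length W′ ≤ 31 * length W

  step : 1 ≤ q → ∀ ρ W → length (Restriction.S ρ) ≤ q → (∀ C → C ∈ W → 2 * q ≤ width C) → Step ρ W
  step 1≤q ρ [] _ _ = record
    { ρ′ = ρ ; size = n≤1+n _ ; W′ = [] ; W′⊆W = λ () ; split = λ () ; keep = λ p → p ; shrink = z≤n }
  step 1≤q ρ W@(C₀ ∷ W₀) |S|≤q wide = choose (killing-pair ρ |S|≤q 1≤q W wide)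
    where
    open Restriction ρ
    choose : (∃ λ x → ∃ λ h → length W ≤ 32 * ∑ W (λ C → ⟦ kills? ρ C x h ⟧)) → Step ρ W
    choose (x , h , large) = record
      { ρ′ = ρ₁ ; size = ≤-refl ; W′ = W₁ ; W′⊆W = λ i → proj₁ (∈-filter⁻ survives? i)
      ; split = splitW ; keep = keepK ; shrink = shrunk }
      where
      survives? : ∀ C → Dec (¬ Kills ρ C x h)
      survives? C = ¬? (kills? ρ C x h)
      W₁ : List Clause
      W₁ = filter survives? W
      used-fresh : ∃ λ C → Kills ρ C x h
      used-fresh = ∑-witness (λ C → kills? ρ C x h) W (positive large)
        where
        positive : ∀ {a b} → suc a ≤ 32 * b → 1 ≤ b
        positive {b = suc b} _ = s≤s z≤n
      x∉S : x ∉ S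
      x∉S = proj₁ (proj₂ used-fresh)
      h∉T : h ∉ map α S
      h∉T = proj₁ (proj₂ (proj₂ used-fresh))
      ρ₁ : Restriction
      ρ₁ = record { α = update α x h ; S = x ∷ S
                  ; inj = λ i j → InjectiveOn-update {P = _∈ S} inj
                            (λ y y∈ _ e → h∉T (subst (_∈ map α S) e (∈-map⁺ α y∈))) (cases i) (cases j) }
        where
        cases : ∀ {y} → y ∈ x ∷ S → y ≡ x ⊎ y ∈ S
        cases (here e)  = inj₁ e
        cases (there i) = inj₂ i
      splitW : ∀ {C} → C ∈ W → Killed ρ₁ C ⊎ C ∈ W₁
      splitW {C} i with kills? ρ C x h
      ... | yes (_ , _ , s) = inj₁ (x , here refl , subst (λ g → Sat g C x) (sym (update-≡ α x h)) s)
      ... | no n = inj₂ (∈-filter⁺ survives? i n)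
      keepK : ∀ {C} → Killed ρ C → Killed ρ₁ C
      keepK {C} (y , y∈ , s) = y , there y∈ ,
        subst (λ g → Sat g C y) (sym (update-≢ α x h (λ e → x∉S (subst (_∈ S) e y∈)))) s
      f = ∑ W (λ C → ⟦ kills? ρ C x h ⟧)
      shrunk : 32 * length W₁ ≤ 31 * length W
      shrunk = +-cancelʳ-≤ (length W) _ _ (begin
        32 * length W₁ + length W   ≤⟨ +-monoʳ-≤ (32 * length W₁) large ⟩
        32 * length W₁ + 32 * f     ≡⟨ *-distribˡ-+ 32 (length W₁) f ⟨
        32 * (length W₁ + f)        ≡⟨ cong (32 *_) (length-filter-¬ (λ C → kills? ρ C x h) W) ⟩
        32 * length W               ≡⟨ +-comm (length W) (31 * length W) ⟩
        31 * length W + length W    ∎)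
        where open ≤-Reasoning

  -- `t` is the number of choices still to be made. Each adds at most one pigeon, so the budget q
  -- keeps `step` applicable, and the survivors decay like (31/32)^t.
  greedy : 1 ≤ q → ∀ t ρ W → length (Restriction.S ρ) + t ≤ q → (∀ C → C ∈ W → 2 * q ≤ width C) →
           Σ Restriction λ ρ′ → Σ (List Clause) λ W′ → length (Restriction.S ρ′) ≤ q ×
             (∀ {C} → C ∈ W → Killed ρ′ C ⊎ C ∈ W′) × (∀ {C} → Killed ρ C → Killed ρ′ C) ×
             32 ^ t * length W′ ≤ 31 ^ t * length W
  greedy 1≤q zero ρ W b wide = ρ , W , m+n≤o⇒m≤o _ b , inj₂ , (λ p → p) , ≤-refl
  greedy 1≤q (suc t) ρ W b wide with step 1≤q ρ W (m+n≤o⇒m≤o _ b) wide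
  ... | s with greedy 1≤q t (Step.ρ′ s) (Step.W′ s)
                 (≤-trans (+-monoˡ-≤ t (Step.size s)) (≤-trans (≤-reflexive (sym (+-suc _ t))) b))
                 (λ C i → wide C (Step.W′⊆W s i))
  ... | ρ′ , W′ , b′ , split , keep , shrink = ρ′ , W′ , b′ , split′ , (λ p → keep (Step.keep s p)) , (begin
      32 ^ suc t * length W′               ≡⟨ *-assoc 32 (32 ^ t) _ ⟩
      32 * (32 ^ t * length W′)            ≤⟨ *-monoʳ-≤ 32 shrink ⟩
      32 * (31 ^ t * length (Step.W′ s))   ≡⟨ swap 32 (31 ^ t) _ ⟩
      31 ^ t * (32 * length (Step.W′ s))   ≤⟨ *-monoʳ-≤ (31 ^ t) (Step.shrink s) ⟩
      31 ^ t * (31 * length W)             ≡⟨ swap 31 (31 ^ t) _ ⟨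
      31 * (31 ^ t * length W)             ≡⟨ *-assoc 31 (31 ^ t) _ ⟨
      31 ^ suc t * length W                ∎)
    where
    open ≤-Reasoning
    swap : ∀ a b c → a * (b * c) ≡ b * (a * c)
    swap = solve-∀
    split′ : ∀ {C} → C ∈ W → Killed ρ′ C ⊎ C ∈ W′
    split′ i with Step.split s i
    ... | inj₁ κ = inj₁ (keep κ)
    ... | inj₂ j = split j

  -- Narrow clauses are not falsified by matchings that extend the chosen one.

  module Refute (ρ : Restriction) (|S|≤q : length (Restriction.S ρ) ≤ q) (1≤q : 1 ≤ q) where
    open Restriction ρ renaming (α to α₀)

    -- The bound `M` exempts phantom pigeons, so extension variables take arbitrary values.
    Relevant : Clause → ℕ → Set
    Relevant C x = x < M × (x ∈ S ⊎ Mentions C x)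

    Falsifies : (ℕ → Hole) → Clause → Set
    Falsifies α C = ∀ l → l ∈ C → litVal (α (pigeon l)) l ≡ false

    -- The invariant of the derivation. Injectivity is demanded only where `S` or `C` can notice it,
    -- so a pigeon outside both may be reseated freely when it turns up as a pivot.
    Unfalsified : Clause → Set
    Unfalsified C = ∀ α → (∀ x → x ∈ S → α x ≡ α₀ x) → InjectiveOn (Relevant C) α → ¬ Falsifies α C

    Unfalsified-⊆ : ∀ {C D} → (∀ l → l ∈ C → l ∈ D) → Unfalsified C → Unfalsified D
    Unfalsified-⊆ C⊆D u α agree inj f = u α agree (λ p r → inj (grow p) (grow r)) (λ l i → f l (C⊆D l i))
      where
      grow : ∀ {x} → Relevant _ x → Relevant _ x
      grow (b , inj₁ i) = b , inj₁ i
      grow (b , inj₂ m) with find m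
      ... | l , i , e = b , inj₂ (mentioned (C⊆D l i) e)

    -- Falsity of the clause pins every bit of both pigeons to `h`, and then they share a hole.
    bphp-unfalsified : ∀ {C} → C ∈ bphpPow k → Unfalsified C
    bphp-unfalsified C∈ α agree inj f with ∈-bphpPow⁻ C∈
    ... | x , y , h , x<M , y<M , x≢y , refl =
      x≢y (inj (x<M , inj₂ (ment x ∈-++⁺ˡ)) (y<M , inj₂ (ment y (∈-++⁺ʳ (notAt x h))))
               (trans (at x ∈-++⁺ˡ) (sym (at y (∈-++⁺ʳ (notAt x h))))))
      where
      at : ∀ z → (∀ {l} → l ∈ notAt z h → l ∈ notAt x h ++ notAt y h) → α z ≡ h
      at z sub = Pointwise-≡⇒≡ (pointwise bit)
        where
        -- The literal on bit `i` whose falsity says that this bit equals `b`.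
        litOf : ∀ i b → ∃ λ l → pigeon l ≡ z × var l mod k ≡ i × (∀ g → litVal g l ≡ false → lookup g i ≡ b)
                         × (lookup h i ≡ b → litVal h l ≡ false)
        litOf i false = pos (pvar k z i) , pvar-/ z i , pvar-mod z i
          , (λ g e → subst (λ j → lookup g j ≡ false) (pvar-mod z i) e)
          , (λ e → subst (λ j → lookup h j ≡ false) (sym (pvar-mod z i)) e)
        litOf i true = neg (pvar k z i) , pvar-/ z i , pvar-mod z i
          , (λ g e → subst (λ j → lookup g j ≡ true) (pvar-mod z i) (not-false e))
          , (λ e → subst (λ j → not (lookup h j) ≡ false) (sym (pvar-mod z i)) (cong not e))
          where
          not-false : ∀ {b} → not b ≡ false → b ≡ true
          not-false {true} _ = refl
        bit : ∀ i → lookup (α z) i ≡ lookup h i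
        bit i with litOf i (lookup h i)
        ... | l , p , _ , val , here-false =
          val (α z) (subst (λ w → litVal (α w) l ≡ false) p (f l (sub (∈-notAt⁺ {z} {h} l p (here-false refl)))))
      ment : ∀ z → (∀ {l} → l ∈ notAt z h → l ∈ notAt x h ++ notAt y h) → Mentions (notAt x h ++ notAt y h) z
      ment z sub = mentioned (sub (∈-map⁺ _ (∈-allFin (0 mod k)))) (proj₁ (∈-notAt⁻ {z} {h} (∈-map⁺ _ (∈-allFin (0 mod k)))))

    killed-unfalsified : ∀ {C} → Killed ρ C → Unfalsified C
    killed-unfalsified (x , x∈S , s) α agree _ f with find s
    ... | l , l∈C , refl , v with trans (sym v) (trans (cong (λ g → litVal g l) (sym (agree _ x∈S))) (f l l∈C))
    ... | ()

    -- A seating that falsifies `C` falsifies one premise too, chosen by the value of the pivot. The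
    -- premises add at most the pivot's pigeon to those relevant for `C`. If that pigeon is new it
    -- needs a free hole, and fewer than q + 2q of the 4q holes are taken.
    resolvent-unfalsified : ∀ {Γ C} → ResolutionOf Γ C → width C < 2 * q →
                            (∀ D → D ∈ Γ → Unfalsified D) → Unfalsified C
    resolvent-unfalsified {Γ} {C} r narrow hyp α agree injα f = finish (pigeon pivot <? M)
      where
      open ResolutionOf r

      contradict : ∀ β → (∀ x → x ∈ S → β x ≡ α₀ x) →
                   InjectiveOn (λ z → (z ≡ pigeon pivot × z < M) ⊎ Relevant C z) β →
                   Falsifies β C → ⊥
      contradict β agreeβ injβ fβ with litVal (β (pigeon pivot)) pivot in eq
      ... | false = hyp C1 C1∈ β agreeβ (λ p s → injβ (grow p) (grow s)) fals
        where
        grow : ∀ {z} → Relevant C1 z → (z ≡ pigeon pivot × z < M) ⊎ Relevant C z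
        grow (b , inj₁ i) = inj₂ (b , inj₁ i)
        grow (b , inj₂ m) with find m
        ... | l , i , e with l ≟ₗ pivot
        ...   | yes refl = inj₁ (sym e , b)
        ...   | no n = inj₂ (b , inj₂ (mentioned (complete l (inj₁ (i , n))) e))
        fals : Falsifies β C1
        fals l i with l ≟ₗ pivot
        ... | yes refl = eq
        ... | no n = fβ l (complete l (inj₁ (i , n)))
      ... | true = hyp C2 C2∈ β agreeβ (λ p s → injβ (grow p) (grow s)) fals
        where
        grow : ∀ {z} → Relevant C2 z → (z ≡ pigeon pivot × z < M) ⊎ Relevant C z
        grow (b , inj₁ i) = inj₂ (b , inj₁ i)
        grow (b , inj₂ m) with find m
        ... | l , i , e with l ≟ₗ negate pivot
        ...   | yes refl = inj₁ (trans (sym e) (pigeon-negate pivot) , b)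
        ...   | no n = inj₂ (b , inj₂ (mentioned (complete l (inj₂ (i , n))) e))
        fals : Falsifies β C2
        fals l i with l ≟ₗ negate pivot
        ... | yes refl = trans (cong (λ z → litVal (β z) (negate pivot)) (pigeon-negate pivot))
                               (trans (litVal-negate (β (pigeon pivot)) pivot) (cong not eq))
        ... | no n = fβ l (complete l (inj₂ (i , n)))

      x = pigeon pivot

      used : List ℕ
      used = S ++ filter (mentions? C) (upTo M)

      ∈-used : ∀ {z} → Relevant C z → z ∈ used
      ∈-used (b , inj₁ i) = ∈-++⁺ˡ i
      ∈-used (b , inj₂ m) = ∈-++⁺ʳ S (∈-filter⁺ (mentions? C) (∈-upTo⁺ b) m)

      used-small : length (map α used) < 2 ^ k
      used-small = begin-strict
        length (map α used)        ≡⟨ length-map α used ⟩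
        length used                ≡⟨ length-++ S ⟩
        length S + length (filter (mentions? C) (upTo M)) ≡⟨ cong (length S +_) (length-filter≡∑ (mentions? C) (upTo M)) ⟩
        length S + width C         <⟨ +-mono-≤-< |S|≤q narrow ⟩
        q + 2 * q                  ≤⟨ m≤n+m (q + 2 * q) q ⟩
        q + (q + 2 * q)            ≡⟨ four q ⟩
        4 * q                      ≡⟨ 4q ⟩
        2 ^ k                      ∎
        where
        open ≤-Reasoning
        four : ∀ a → a + (a + 2 * a) ≡ 4 * a
        four = solve-∀

      finish : Dec (pigeon pivot < M) → ⊥
      -- A phantom pivot is subject to no injectivity, so `α` serves as it is.
      finish (no phantom) = contradict α agree (λ p s → injα (drop p) (drop s)) f
        where
        drop : ∀ {z} → (z ≡ x × z < M) ⊎ Relevant C z → Relevant C z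
        drop (inj₁ (refl , b)) = ⊥-elim (phantom b)
        drop (inj₂ p) = p
      finish (yes x<M) with x ∈ₙ? S | mentions? C x
      ... | yes x∈S | _ = contradict α agree (λ p s → injα (drop p) (drop s)) f
        where
        drop : ∀ {z} → (z ≡ x × z < M) ⊎ Relevant C z → Relevant C z
        drop (inj₁ (refl , b)) = b , inj₁ x∈S
        drop (inj₂ p) = p
      ... | no _ | yes m = contradict α agree (λ p s → injα (drop p) (drop s)) f
        where
        drop : ∀ {z} → (z ≡ x × z < M) ⊎ Relevant C z → Relevant C z
        drop (inj₁ (refl , b)) = b , inj₂ m
        drop (inj₂ p) = p
      ... | no x∉S | no x∉C with fresh-hole (map α used) used-small
      -- `C` does not mention `x`, so it stays falsified after `x` is moved to `h`.
      ...   | h , h∉ = contradict (update α x h)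
                (λ z z∈ → trans (update-≢ α x h (λ e → x∉S (subst (_∈ S) e z∈))) (agree z z∈))
                (λ p s → InjectiveOn-update {P = Relevant C} injα
                   (λ y py _ e → h∉ (subst (_∈ map α used) e (∈-map⁺ α (∈-used py)))) (drop p) (drop s))
                (λ l i → trans (cong (λ g → litVal g l) (update-≢ α x h (λ e → x∉C (mentioned i e)))) (f l i))
        where
        drop : ∀ {z} → (z ≡ x × z < M) ⊎ Relevant C z → z ≡ x ⊎ Relevant C z
        drop (inj₁ (e , _)) = inj₁ e
        drop (inj₂ p) = inj₂ p

    G-unfalsified : ∀ C → C ∈ G → Unfalsified C
    G-unfalsified C i with ∈-𝒢⁻ π i
    ... | inj₁ j = bphp-unfalsified j
    ... | inj₂ (_ , _ , l , _ , D , D∈ , refl) = Unfalsified-⊆ (λ _ → there) (bphp-unfalsified D∈)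

    refute : ∀ {Γ N} (p : Proof (Restricted G SBCRule) Γ N) → (∀ D → D ∈ G → D ∈ Γ) →
             (∀ C → C ∈ added p → Killed ρ C ⊎ width C < 2 * q) → (∀ C → C ∈ Γ → Unfalsified C) → ⊥
    -- `α₀` falsifies the empty clause vacuously and is injective on `S`, which contains all
    -- relevant pigeons.
    refute (done ⊥∈) _ _ unf = unf [] ⊥∈ α₀ (λ _ _ → refl)
      (λ { (_ , inj₁ i) (_ , inj₁ j) e → inj i j e }) (λ _ ())
    refute (add {Γ} {C} (rule , occ) p) G⊆Γ ok unf =
      refute p (λ D i → there (G⊆Γ D i)) (λ D i → ok D (there i)) unf′
      where
      new : SBCRule Γ C → Killed ρ C ⊎ width C < 2 * q → Unfalsified C
      new _ (inj₁ κ) = killed-unfalsified κ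
      new (inj₁ r) (inj₂ narrow) = resolvent-unfalsified r narrow unf
      new (inj₂ (inj₁ (_ , D , D∈ , D⊆))) (inj₂ narrow) = Unfalsified-⊆ D⊆ (unf D D∈)
      new (inj₂ (inj₂ s)) (inj₂ narrow) = ⊥-elim (<⇒≱ narrow (wide-count (proj₂ (sbc-wide G⊆Γ occ s))))
      unf′ : ∀ D → D ∈ C ∷ Γ → Unfalsified D
      unf′ D (here refl) = new rule (ok C (here refl))
      unf′ D (there i) = unf D i

  lower-contradiction : ∀ {j N} → q ≡ 32 * j → 1 ≤ j → N < 2 ^ j → ¬ SBC⁻Proof G N
  lower-contradiction {j} {N} refl 1≤j N<2^j p = conclude (greedy 1≤q q ρ₀ W ≤-refl (λ C i → proj₂ (∈-filter⁻ wide? {xs = added p} i)))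
    where
    1≤q : 1 ≤ 32 * j
    1≤q = ≤-trans 1≤j (m≤m+n j _)
    wide? : ∀ C → Dec (2 * q ≤ width C)
    wide? C = 2 * q ≤? width C
    W : List Clause
    W = filter wide? (added p)
    ρ₀ : Restriction
    ρ₀ = record { α = λ _ → tabulate (λ _ → true) ; S = [] ; inj = λ () }
    |W|<2^j : length W < 2 ^ j
    |W|<2^j = ≤-<-trans (length-filter wide? (added p))
                (<-trans (subst (length (added p) <_) (length-added p) ≤-refl) N<2^j)

    -- Every 32 choices at least halve the survivors: (32/31)^32 ≥ 2, checked by evaluation.
    rate : 31 ^ (32 * j) * 2 ^ j ≤ 32 ^ (32 * j)
    rate = begin
      31 ^ (32 * j) * 2 ^ j     ≡⟨ cong (_* 2 ^ j) (^-*-assoc 31 32 j) ⟨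
      (31 ^ 32) ^ j * 2 ^ j     ≡⟨ ^-distribʳ-* j (31 ^ 32) 2 ⟨
      (31 ^ 32 * 2) ^ j         ≤⟨ ^-monoˡ-≤ j (≤ᵇ⇒≤ (31 ^ 32 * 2) (32 ^ 32) _) ⟩
      (32 ^ 32) ^ j             ≡⟨ ^-*-assoc 32 32 j ⟩
      32 ^ (32 * j)             ∎
      where open ≤-Reasoning

    conclude : (Σ Restriction λ ρ′ → Σ (List Clause) λ W′ → length (Restriction.S ρ′) ≤ q ×
             (∀ {C} → C ∈ W → Killed ρ′ C ⊎ C ∈ W′) × (∀ {C} → Killed ρ₀ C → Killed ρ′ C) ×
             32 ^ q * length W′ ≤ 31 ^ q * length W) → ⊥
    -- A single surviving wide clause would already force 2 ^ j ≤ `length W`.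
    conclude (ρ′ , W′@(_ ∷ _) , _ , _ , _ , shrink) = <⇒≱ |W|<2^j
      (*-cancelˡ-≤ (31 ^ q) {{m^n≢0 31 q}} (begin
        31 ^ q * 2 ^ j       ≤⟨ rate ⟩
        32 ^ q               ≡⟨ *-identityʳ _ ⟨
        32 ^ q * 1           ≤⟨ *-monoʳ-≤ (32 ^ q) (s≤s z≤n) ⟩
        32 ^ q * length W′   ≤⟨ shrink ⟩
        31 ^ q * length W    ∎))
      where open ≤-Reasoning
    conclude (ρ′ , [] , b , split , _ , _) =
      Refute.refute ρ′ b 1≤q p (λ _ i → i) classify (Refute.G-unfalsified ρ′ b 1≤q)
      where
      classify : ∀ C → C ∈ added p → Killed ρ′ C ⊎ width C < 2 * q
      classify C i with wide? C
      ... | no n = inj₂ (≰⇒> n)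
      ... | yes w with split (∈-filter⁺ wide? i w)
      ...   | inj₁ κ = inj₁ κ

-- The lower bound in terms of n.

n<2^1+log₂n : ∀ n → n < 2 ^ suc ⌊log₂ n ⌋
n<2^1+log₂n n with 2 ^ suc ⌊log₂ n ⌋ ≤? n
... | no ≰n = ≰⇒> ≰n
... | yes ≤n = ⊥-elim (1+n≰n (subst (_≤ ⌊log₂ n ⌋) (⌊log₂[2^n]⌋≡n _) (⌊log₂⌋-mono-≤ ≤n)))

-- 128 = 4 · 32: a factor 4 because q is a quarter of the holes, and 32 because q = 32j choices are
-- made. From n ≥ 128 follows k ≥ 7, so that j = 2^(k - 7) is exact, and n < 2 · 2^k = 256j gives
-- the exponent.
lower-bound : ∀ n → 128 ≤ n → (π : ERProof (BPHP n)) → ∀ N → SBC⁻Proof (𝒢 (BPHP n) π) N → 2 ^ n ≤ N ^ 256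
lower-bound n 128≤n π N p = by (2 ^ j ≤? N)
  where
  k = ⌊log₂ n ⌋
  j = 2 ^ (k ∸ 7)
  7≤k : 7 ≤ k
  7≤k = subst (_≤ k) (⌊log₂[2^n]⌋≡n 7) (⌊log₂⌋-mono-≤ 128≤n)
  instance
    k≢0 : NonZero k
    k≢0 = >-nonZero (≤-trans (s≤s z≤n) 7≤k)
  2^k≡ : 128 * j ≡ 2 ^ k
  2^k≡ = trans (sym (^-distribˡ-+-* 2 7 (k ∸ 7))) (cong (2 ^_) (m+[n∸m]≡n 7≤k))
  4q : 4 * (32 * j) ≡ 2 ^ k
  4q = trans (sym (*-assoc 4 32 j)) 2^k≡
  by : Dec (2 ^ j ≤ N) → 2 ^ n ≤ N ^ 256
  by (no ≰N) = ⊥-elim (Lower.lower-contradiction k π (32 * j) 4q refl (m^n>0 2 (k ∸ 7)) (≰⇒> ≰N) p)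
  by (yes ≤N) = begin
    2 ^ n               ≤⟨ ^-monoʳ-≤ 2 (<⇒≤ (n<2^1+log₂n n)) ⟩
    2 ^ (2 * 2 ^ k)     ≡⟨ cong (λ a → 2 ^ (2 * a)) 2^k≡ ⟨
    2 ^ (2 * (128 * j)) ≡⟨ cong (2 ^_) (trans (sym (*-assoc 2 128 j)) (*-comm 256 j)) ⟩
    2 ^ (j * 256)       ≡⟨ ^-*-assoc 2 j 256 ⟨
    (2 ^ j) ^ 256       ≤⟨ ^-monoˡ-≤ 256 ≤N ⟩
    N ^ 256             ∎
    where open ≤-Reasoning

-- Simulating ER in RAT⁻: derivation sequences and unit propagation.

infix 4 _⊑_
_⊑_ : ∀ {A : Set} → List A → List A → Set
xs ⊑ ys = ∀ x → x ∈ xs → x ∈ ys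

data Steps (R : Rule) : Formula → ℕ → Formula → Set where
  stop : ∀ {Γ} → Steps R Γ 0 Γ
  step : ∀ {Γ C n Δ} → R Γ C → Steps R (C ∷ Γ) n Δ → Steps R Γ (suc n) Δ

module _ {R : Rule} where
  Steps-trans : ∀ {Γ Δ Λ m n} → Steps R Γ m Δ → Steps R Δ n Λ → Steps R Γ (m + n) Λ
  Steps-trans stop       t = t
  Steps-trans (step r s) t = step r (Steps-trans s t)

  Steps-⊑ : ∀ {Γ Δ n} → Steps R Γ n Δ → Γ ⊑ Δ
  Steps-⊑ stop       _ i = i
  Steps-⊑ (step _ s) C i = Steps-⊑ s C (there i)

  Steps-Proof : ∀ {Γ Δ m n} → Steps R Γ m Δ → Proof R Δ n → Proof R Γ (m + n)
  Steps-Proof stop       p = p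
  Steps-Proof (step r s) p = add r (Steps-Proof s p)

-- `n` is only an upper bound, since a clause that is already subsumed takes no step.
Reach : Rule → Formula → ℕ → (Formula → Set) → Set
Reach R Γ n P = Σ Formula λ Δ → Σ ℕ λ m → m ≤ n × Steps R Γ m Δ × P Δ

module _ {R : Rule} where
  pure : ∀ {Γ n P} → P Γ → Reach R Γ n P
  pure p = _ , 0 , z≤n , stop , p

  infixl 1 _>>=_
  _>>=_ : ∀ {Γ m n P Q} → Reach R Γ m P → (∀ {Δ} → Γ ⊑ Δ → P Δ → Reach R Δ n Q) → Reach R Γ (m + n) Q
  (_ , _ , a , s , p) >>= f with f (Steps-⊑ s) p
  ... | _ , _ , b , t , q = _ , _ , +-mono-≤ a b , Steps-trans s t , q

  Reach-map : ∀ {Γ n P Q} → (∀ {Δ} → Γ ⊑ Δ → P Δ → Q Δ) → Reach R Γ n P → Reach R Γ n Q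
  Reach-map f (_ , _ , a , s , p) = _ , _ , a , s , f (Steps-⊑ s) p

  weaken : ∀ {Γ m n P} → m ≤ n → Reach R Γ m P → Reach R Γ n P
  weaken m≤n (_ , _ , a , s , p) = _ , _ , ≤-trans a m≤n , s , p

IsClause-⊑ : ∀ {C D} → C ⊑ D → IsClause D → IsClause C
IsClause-⊑ C⊑D d (v , i , j) = d (v , C⊑D _ i , C⊑D _ j)

⊑[]⇒[]∈ : ∀ {C : Clause} {Γ} → C ⊑ [] → C ∈ Γ → [] ∈ Γ
⊑[]⇒[]∈ {[]}    _ i = i
⊑[]⇒[]∈ {l ∷ _} h _ with h l (here refl)
... | ()

∈-remove⁺ : ∀ {p l C} → l ∈ C → l ≢ p → l ∈ remove p C
∈-remove⁺ {p} = ∈-filter⁺ (λ l → ¬? (l ≟ₗ p))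

∈-remove⁻ : ∀ {p l C} → l ∈ remove p C → l ∈ C × l ≢ p
∈-remove⁻ {p} = ∈-filter⁻ (λ l → ¬? (l ≟ₗ p))

resolve : ∀ {Γ C D} l → C ∈ Γ → D ∈ Γ → l ∈ C → negate l ∈ D →
          IsClause (remove l C ++ remove (negate l) D) →
          ResolutionOf Γ (remove l C ++ remove (negate l) D)
resolve {Γ} {C} {D} l C∈ D∈ l∈ l̄∈ cl = record
  { C1 = C ; C2 = D ; C1∈ = C∈ ; C2∈ = D∈ ; pivot = l ; pivot∈ = l∈ ; npivot∈ = l̄∈
  ; isClause = cl ; sound = sound ; complete = complete }
  where
  sound : ∀ a → a ∈ remove l C ++ remove (negate l) D → (a ∈ C × a ≢ l) ⊎ (a ∈ D × a ≢ negate l)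
  sound a i with ∈-++⁻ (remove l C) i
  ... | inj₁ j = inj₁ (∈-remove⁻ j)
  ... | inj₂ j = inj₂ (∈-remove⁻ j)
  complete : ∀ a → (a ∈ C × a ≢ l) ⊎ (a ∈ D × a ≢ negate l) → a ∈ remove l C ++ remove (negate l) D
  complete a (inj₁ (i , n)) = ∈-++⁺ˡ (∈-remove⁺ i n)
  complete a (inj₂ (i , n)) = ∈-++⁺ʳ (remove l C) (∈-remove⁺ i n)

-- The literals of `D` are resolved away against their negated units. `n` bounds the length and is
-- the recursion measure, because the resolvent is not a structural part of `D`.
unit-refute : ∀ n {Γ} D → length D ≤ n → IsClause D → D ∈ Γ → (∀ l → l ∈ D → (negate l ∷ []) ∈ Γ) →
              Σ ℕ (Proof UPRule Γ)
unit-refute _ [] _ _ D∈ _ = 1 , done D∈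
unit-refute (suc n) {Γ} D@(l ∷ D′) (s≤s le) cl D∈ units = _ ,
  add (inj₁ (r , inj₂ λ { a (here refl) → refl }))
      (proj₂ (unit-refute n R shorter R-clause (here refl) (λ a i → there (units a (R⊑D a i)))))
  where
  R : Clause
  R = remove l D ++ remove (negate l) (negate l ∷ [])
  R⊑D : R ⊑ D
  R⊑D a i with ∈-++⁻ (remove l D) i
  ... | inj₁ j = proj₁ (∈-remove⁻ j)
  ... | inj₂ j with ∈-remove⁻ {negate l} {a} {negate l ∷ []} j
  ...   | here refl , n = ⊥-elim (n refl)
  R-clause : IsClause R
  R-clause = IsClause-⊑ R⊑D cl
  r : ResolutionOf Γ R
  r = resolve l D∈ (units l (here refl)) (here refl) (here refl) R-clause
  shorter : length R ≤ n
  shorter with l ≟ₗ l | negate l ≟ₗ negate l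
  ... | no n | _ = ⊥-elim (n refl)
  ... | yes _ | no n = ⊥-elim (n refl)
  ... | yes _ | yes _ = ≤-trans (≤-reflexive (cong length (++-identityʳ (remove l D′)))) (≤-trans (length-filter _ D′) le)

⊢₁-subsumed : ∀ {Γ D L} → IsClause D → D ∈ Γ → D ⊑ L → Γ ⊢₁ L
⊢₁-subsumed {Γ} {D} {L} cl D∈ D⊑L =
  unit-refute (length D) D ≤-refl cl (∈-++⁺ʳ _ D∈) (λ l i → ∈-++⁺ˡ (∈-map⁺ (λ l → negate l ∷ []) (D⊑L l i)))

⊢₁-compl : ∀ {Γ L} l → l ∈ L → negate l ∈ L → Γ ⊢₁ L
⊢₁-compl {Γ} {L} l i j = unit-refute 1 (negate l ∷ []) ≤-refl single (unit i) λ { _ (here refl) → unit j }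
  where
  unit : ∀ {a} → a ∈ L → (negate a ∷ []) ∈ map (λ l → negate l ∷ []) L ++ Γ
  unit k = ∈-++⁺ˡ (∈-map⁺ (λ l → negate l ∷ []) k)
  single : IsClause (negate l ∷ [])
  single (v , here e , here e′) with trans e (sym e′)
  ... | ()

-- Variables foreign to the given formula are set to true throughout the ER proof;
-- the remaining extension clauses are then added as RATs, x ∨ p̄ ∨ q̄ first.
module Simulate {Γ : Formula} (π : ERProof Γ) (Γ-clauses : ∀ D → D ∈ Γ → IsClause D) {D* : Clause} (D*∈ : D* ∈ Γ) where
  open ERProof π

  G : Formula
  G = 𝒢 Γ π

  Known : Lit → Set
  Known l = Occurs (var l) G

  known? : ∀ l → Dec (Known l)
  known? l = map′ (λ a → let D , D∈ , b = find a in D , D∈ , find b) (λ { (D , D∈ , b , b∈ , e) → lose D∈ (lose b∈ e) })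
               (any? (λ D → any? (λ b → var b ≟ var l) D) G)

  known-negate : ∀ l → Known (negate l) → Known l
  known-negate l (D , D∈ , b , b∈ , e) = D , D∈ , b , b∈ , trans e (var-negate l)

  True : Lit → Set
  True (pos v) = ¬ Known (pos v)
  True (neg v) = ⊥

  true? : ∀ l → Dec (True l)
  true? (pos v) = ¬? (known? (pos v))
  true? (neg v) = no λ ()

  True-unknown : ∀ l → True l → ¬ Known l
  True-unknown (pos v) t = t

  True-negate : ∀ l → True l → ¬ True (negate l)
  True-negate (pos v) _ ()

  unknown⇒ : ∀ l → ¬ Known l → True l ⊎ True (negate l)
  unknown⇒ (pos v) n = inj₁ n
  unknown⇒ (neg v) n = inj₂ n

  Satisfied : Clause → Set
  Satisfied C = Any True C

  satisfied? : ∀ C → Dec (Satisfied C)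
  satisfied? = any? true?

  -- Invariant of the replay: a clause satisfied by the assignment may be missing; any other is
  -- present up to subsumption, and `AllKnown` rids it of foreign literals.
  Has : Formula → Clause → Set
  Has Δ C = Satisfied C ⊎ (∃ λ D → D ∈ Δ × D ⊑ C)

  Has-mono : ∀ {Δ Δ′ C} → Δ ⊑ Δ′ → Has Δ C → Has Δ′ C
  Has-mono sub (inj₁ s) = inj₁ s
  Has-mono sub (inj₂ (D , D∈ , h)) = inj₂ (D , sub D D∈ , h)

  AllKnown : Formula → Set
  AllKnown Δ = ∀ D → D ∈ Δ → ∀ l → l ∈ D → Known l

  RAT⁻ : Rule
  RAT⁻ = Restricted G RATRule

  Keeps : Formula → Clause → Formula → Set
  Keeps Δ C Δ′ = Δ ⊑ Δ′ × AllKnown Δ′ × Has Δ′ C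

  -- If a premise is satisfied at the pivot, the pivot variable is foreign. The clause kept for the
  -- other premise then lacks it and already subsumes the resolvent.
  resolve-step : ∀ {Σ′ Δ C} → ResolutionOf Σ′ C → (∀ D → D ∈ Σ′ → Has Δ D) → AllKnown Δ →
                 Reach RAT⁻ Δ 1 (Keeps Δ C)
  resolve-step {Σ′} {Δ} {C} r has known = by (has C1 C1∈) (has C2 C2∈)
    where
    open ResolutionOf r
    from1 : ∀ {l} → l ∈ C1 → l ≢ pivot → l ∈ C
    from1 i n = complete _ (inj₁ (i , n))
    from2 : ∀ {l} → l ∈ C2 → l ≢ negate pivot → l ∈ C
    from2 i n = complete _ (inj₂ (i , n))
    same : Has Δ C → Reach RAT⁻ Δ 1 (Keeps Δ C)
    same h = pure ((λ _ i → i) , known , h)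
    by : Has Δ C1 → Has Δ C2 → Reach RAT⁻ Δ 1 (Keeps Δ C)
    by (inj₁ s1) h2 with find s1
    ... | l , l∈ , t with l ≟ₗ pivot
    ...   | no n = same (inj₁ (lose (from1 l∈ n) t))
    ...   | yes refl with h2
    ...     | inj₂ (D , D∈ , D⊑) = same (inj₂ (D , D∈ , λ a i → from2 (D⊑ a i)
                (λ { refl → True-unknown l t (known-negate pivot (known D D∈ _ i)) })))
    ...     | inj₁ s2 with find s2
    ...       | a , a∈ , t2 = same (inj₁ (lose (from2 a∈ (λ { refl → True-negate l t t2 })) t2))
    by (inj₂ (D , D∈ , D⊑)) (inj₁ s2) with find s2
    ... | a , a∈ , t2 with a ≟ₗ negate pivot
    ...   | no n = same (inj₁ (lose (from2 a∈ n) t2))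
    ...   | yes refl = same (inj₂ (D , D∈ , λ b i → from1 (D⊑ b i)
              (λ { refl → True-unknown (negate b) t2
                   (known-negate (negate b) (subst Known (sym (negate-negate b)) (known D D∈ b i))) })))
    by (inj₂ (D , D∈ , D⊑)) (inj₂ (E , E∈ , E⊑)) with pivot ∈? D | negate pivot ∈? E
    ... | no n | _ = same (inj₂ (D , D∈ , λ b i → from1 (D⊑ b i) (λ { refl → n i })))
    ... | _ | no n = same (inj₂ (E , E∈ , λ b i → from2 (E⊑ b i) (λ { refl → n i })))
    ... | yes i | yes j = R ∷ Δ , 1 , ≤-refl , step (inj₁ resolvent , R-known) stop ,
          (λ _ → there) , (λ { B (here refl) → R-known ; B (there k) → known B k }) , inj₂ (R , here refl , R⊑C)
      where
      R = remove pivot D ++ remove (negate pivot) E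
      R⊑C : R ⊑ C
      R⊑C a k with ∈-++⁻ (remove pivot D) k
      ... | inj₁ m = let i , n = ∈-remove⁻ {pivot} {a} {D} m in from1 (D⊑ a i) n
      ... | inj₂ m = let i , n = ∈-remove⁻ {negate pivot} {a} {E} m in from2 (E⊑ a i) n
      R-known : ∀ a → a ∈ R → Known a
      R-known a k with ∈-++⁻ (remove pivot D) k
      ... | inj₁ m = known D D∈ a (proj₁ (∈-remove⁻ {pivot} {a} {D} m))
      ... | inj₂ m = known E E∈ a (proj₁ (∈-remove⁻ {negate pivot} {a} {E} m))
      resolvent = resolve pivot D∈ E∈ i j (IsClause-⊑ R⊑C isClause)

  -- Weakenings are absorbed by subsumption, so the variables they introduce never enter the replay.
  simulate-res : ∀ {Σ′ n Δ} → Proof ResRule Σ′ n → (∀ D → D ∈ Σ′ → Has Δ D) → AllKnown Δ →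
                 ∃ λ N → N ≤ n × Proof RAT⁻ Δ N
  simulate-res (done ⊥∈) has known with has [] ⊥∈
  ... | inj₂ (D , D∈ , D⊑) = 1 , ≤-refl , done (⊑[]⇒[]∈ D⊑ D∈)
  simulate-res {Δ = Δ} (add {C = C} rule p) has known with one rule
    where
    one : ResRule _ C → Reach RAT⁻ Δ 1 (Keeps Δ C)
    one (inj₁ r) = resolve-step r has known
    one (inj₂ (_ , D , D∈ , D⊑)) with has D D∈
    ... | inj₁ s = pure ((λ _ i → i) , known , inj₁ (let l , l∈ , t = find s in lose (D⊑ l l∈) t))
    ... | inj₂ (E , E∈ , E⊑) = pure ((λ _ i → i) , known , inj₂ (E , E∈ , λ a i → D⊑ a (E⊑ a i)))
  ... | Δ′ , m , m≤1 , s , sub , known′ , h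
      with simulate-res p (λ { D (here refl) → h ; D (there i) → Has-mono sub (has D i) }) known′
  ...   | N , N≤n , p′ = m + N , +-mono-≤ m≤1 N≤n , Steps-Proof s p′

  reduct : Clause → Clause
  reduct = filter known?

  reduct⊑ : ∀ C → reduct C ⊑ C
  reduct⊑ C l i = proj₁ (∈-filter⁻ known? {xs = C} i)

  ∈-reduct : ∀ {l C} → l ∈ C → Known l → l ∈ reduct C
  ∈-reduct = ∈-filter⁺ known?

  record Added (Δ : Formula) (E : Clause) (Δ′ : Formula) : Set where
    field
      old   : Δ ⊑ Δ′
      known : AllKnown Δ′
      has   : Has Δ′ E
      new   : ∀ {D} → D ∈ Δ′ → D ∈ Δ ⊎ (D ≡ reduct E × ¬ Satisfied E)

  add-RAT : ∀ {Δ} E p → AllKnown Δ → IsClause E → p ∈ E → Known p →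
            (¬ Satisfied E → ∀ D → D ∈ Δ → negate p ∈ D →
               Δ ⊢₁ (remove p (reduct E) ++ remove (negate p) D)) →
            Reach RAT⁻ Δ 1 (Added Δ E)
  add-RAT {Δ} E p known cl p∈ kp rat with satisfied? E
  ... | yes s = pure record { old = λ _ i → i ; known = known ; has = inj₁ s ; new = inj₁ }
  ... | no ns = reduct E ∷ Δ , 1 , ≤-refl ,
        step (inj₂ (inj₂ (IsClause-⊑ (reduct⊑ E) cl , p , ∈-reduct p∈ kp , rat ns)) , known′) stop ,
        record { old = λ _ → there ; known = λ { D (here refl) → known′ ; D (there i) → known D i }
               ; has = inj₂ (reduct E , here refl , reduct⊑ E)
               ; new = λ { (here refl) → inj₂ (refl , ns) ; (there i) → inj₁ i } }
    where
    known′ : ∀ l → l ∈ reduct E → Known l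
    known′ l i = proj₂ (∈-filter⁻ known? {xs = E} i)

  -- Clauses on `x` that put no constraint on it: each contains a clause of Γ without `x`, which
  -- settles the RAT test against it.
  Guarded : Formula → ℕ → Set
  Guarded Δ x = ∀ D → D ∈ Δ → ∀ l → l ∈ D → var l ≡ x →
                ∃ λ D₀ → D₀ ∈ Γ × (∀ d → d ∈ D₀ → d ∈ D × var d ≢ x)

  -- The clause `D*` makes x ∨ Γ and x̄ ∨ Γ nonempty, which is how the extension variable comes to
  -- occur in `G`.
  extension-known : ∀ {e} l → e ∈ exts → var l ≡ proj₁ e → ¬ Occurs (proj₁ e) Γ → Known l
  extension-known {e} l e∈ v fresh = l ∷ D* , ∈-𝒢-ext⁺ π l e∈ v D*∈ l̄∉ , l , here refl , refl
    where
    l̄∉ : negate l ∉ D*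
    l̄∉ i = fresh (D* , D*∈ , negate l , i , trans (var-negate l) v)

  module _ {Δ x p q} (e∈ : (x , p , q) ∈ exts) (fresh : ¬ Occurs x Γ) (x≢p : x ≢ var p) (x≢q : x ≢ var q)
           (E3-clause : IsClause (pos x ∷ negate p ∷ negate q ∷ []))
           (Γ⊑Δ : Γ ⊑ Δ) (guarded : Guarded Δ x) where
    E1 E2 E3 : Clause
    E1 = neg x ∷ p ∷ []
    E2 = neg x ∷ q ∷ []
    E3 = pos x ∷ negate p ∷ negate q ∷ []

    binary-clause : ∀ {r} → x ≢ var r → IsClause (neg x ∷ r ∷ [])
    binary-clause n (v , there (here refl) , here refl) = n refl
    binary-clause n (v , there (here refl) , there (here ()))

    rat-old : ∀ {Δ′ D l E} → Δ ⊑ Δ′ → var l ≡ x → D ∈ Δ → l ∈ D → Δ′ ⊢₁ (E ++ remove l D)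
    rat-old {Δ′} {D} {l} {E} sub v D∈ l∈ with guarded D D∈ l l∈ v
    ... | D₀ , D₀∈ , h = ⊢₁-subsumed (Γ-clauses D₀ D₀∈) (sub D₀ (Γ⊑Δ D₀ D₀∈))
          (λ d i → ∈-++⁺ʳ E (∈-remove⁺ (proj₁ (h d i)) (λ { refl → proj₂ (h d i) v })))

    -- The two definition clauses also clash on `r`, so their combination is tautological. Were `r`
    -- foreign, its value would satisfy one of them, and that one is not added at all.
    rat-E3 : ∀ {Δ′ r} → x ≢ var r → negate r ∈ E3 → ¬ Satisfied (neg x ∷ r ∷ []) → ¬ Satisfied E3 →
             Δ′ ⊢₁ (remove (neg x) (reduct (neg x ∷ r ∷ [])) ++ remove (pos x) (reduct E3))
    rat-E3 {Δ′} {r} x≢r r̄∈ ns ns3 = ⊢₁-compl r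
      (∈-++⁺ˡ (∈-remove⁺ (∈-reduct (there (here refl)) kr) (λ { refl → x≢r refl })))
      (∈-++⁺ʳ (remove (neg x) (reduct (neg x ∷ r ∷ []))) (∈-remove⁺ (∈-reduct r̄∈ kr̄) (λ e → x≢r (trans (cong var (sym e)) (var-negate r)))))
      where
      kr : Known r
      kr with known? r
      ... | yes k = k
      ... | no n with unknown⇒ r n
      ...   | inj₁ t = ⊥-elim (ns (there (here t)))
      ...   | inj₂ t = ⊥-elim (ns3 (lose r̄∈ t))
      kr̄ : Known (negate r)
      kr̄ = known-negate (negate r) (subst Known (sym (negate-negate r)) kr)

    pos-x∉ : ∀ {r} → x ≢ var r → pos x ∉ reduct (neg x ∷ r ∷ [])
    pos-x∉ {r} n i with reduct⊑ (neg x ∷ r ∷ []) _ i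
    ... | there (here refl) = n refl

    -- The last component traces the origin of every clause: later extension variables do not occur
    -- in the new ones, so they remain `Guarded`.
    add-definition : AllKnown Δ → Reach RAT⁻ Δ 3 (λ Δ′ → Δ ⊑ Δ′ × AllKnown Δ′ ×
                       (∀ C → C ∈ extClauses (x , p , q) → Has Δ′ C) ×
                       (∀ D → D ∈ Δ′ → D ∈ Δ ⊎ (∃ λ E → E ∈ extClauses (x , p , q) × D ≡ reduct E)))
    add-definition known =
      add-RAT E3 (pos x) known E3-clause (here refl) (kx (pos x) refl)
        (λ _ D D∈ → rat-old {E = remove (pos x) (reduct E3)} (λ _ i → i) refl D∈)
      >>= λ {Δ₁} sub₁ a₁ →
      add-RAT E1 (neg x) (Added.known a₁) (binary-clause x≢p) (here refl) (kx (neg x) refl)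
        (λ ns D D∈ → rat-binary x≢p (there (here refl)) sub₁ ns (Added.new a₁ D∈))
      >>= λ {Δ₂} sub₂ a₂ →
      add-RAT E2 (neg x) (Added.known a₂) (binary-clause x≢q) (here refl) (kx (neg x) refl)
        (λ ns D D∈ → rat₂ a₁ a₂ (λ C i → sub₂ C (sub₁ C i)) ns (Added.new a₂ D∈))
      >>= λ {Δ₃} sub₃ a₃ → pure
        ( (λ C i → sub₃ C (sub₂ C (sub₁ C i))) , Added.known a₃
        , (λ { _ (here refl) → Has-mono sub₃ (Added.has a₂)
             ; _ (there (here refl)) → Added.has a₃
             ; _ (there (there (here refl))) → Has-mono (λ C i → sub₃ C (sub₂ C i)) (Added.has a₁) })
        , λ _ i → trace a₁ a₂ (Added.new a₃ i) )
      where
      kx : ∀ l → var l ≡ x → Known l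
      kx l v = extension-known l e∈ v fresh
      rat-binary : ∀ {Δ′ r D} → x ≢ var r → negate r ∈ E3 → Δ ⊑ Δ′ → ¬ Satisfied (neg x ∷ r ∷ []) →
                   D ∈ Δ ⊎ (D ≡ reduct E3 × ¬ Satisfied E3) → pos x ∈ D →
                   Δ′ ⊢₁ (remove (neg x) (reduct (neg x ∷ r ∷ [])) ++ remove (pos x) D)
      rat-binary {r = r} _ _ sub _ (inj₁ i) = rat-old {E = remove (neg x) (reduct (neg x ∷ r ∷ []))} sub refl i
      rat-binary x≢r r̄∈ _ ns (inj₂ (refl , ns3)) _ = rat-E3 x≢r r̄∈ ns ns3
      rat₂ : ∀ {Δ₁ Δ₂ Δ′ D} → Added Δ E3 Δ₁ → Added Δ₁ E1 Δ₂ → Δ ⊑ Δ′ → ¬ Satisfied E2 →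
             D ∈ Δ₁ ⊎ (D ≡ reduct E1 × ¬ Satisfied E1) → pos x ∈ D →
             Δ′ ⊢₁ (remove (neg x) (reduct E2) ++ remove (pos x) D)
      rat₂ a₁ _ sub ns (inj₁ i) = rat-binary x≢q (there (there (here refl))) sub ns (Added.new a₁ i)
      rat₂ _ _ _ _ (inj₂ (refl , _)) i = ⊥-elim (pos-x∉ x≢p i)
      trace : ∀ {Δ₁ Δ₂ D} → Added Δ E3 Δ₁ → Added Δ₁ E1 Δ₂ → D ∈ Δ₂ ⊎ (D ≡ reduct E2 × ¬ Satisfied E2) →
              D ∈ Δ ⊎ (∃ λ E → E ∈ extClauses (x , p , q) × D ≡ reduct E)
      trace a₁ a₂ (inj₂ (e , _)) = inj₂ (E2 , there (here refl) , e)
      trace a₁ a₂ (inj₁ i) with Added.new a₂ i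
      ... | inj₂ (e , _) = inj₂ (E1 , here refl , e)
      ... | inj₁ j with Added.new a₁ j
      ...   | inj₂ (e , _) = inj₂ (E3 , there (there (here refl)) , e)
      ...   | inj₁ m = inj₁ m

  ValidExt-fresh : ∀ {Λ es e} → ValidExt Λ es → e ∈ es → ¬ Occurs (proj₁ e) Λ
  ValidExt-fresh (ext f _ _ _ _) (here refl) = f
  ValidExt-fresh (ext _ _ _ _ v) (there i) (D , D∈ , o) = ValidExt-fresh v i (D , ∈-++⁺ˡ D∈ , o)

  add-definitions : ∀ {Λ Δ es} → ValidExt Λ es → (∀ {e} → e ∈ es → e ∈ exts) → Γ ⊑ Λ → Γ ⊑ Δ →
                    AllKnown Δ → (∀ {e} → e ∈ es → Guarded Δ (proj₁ e)) →
                    Reach RAT⁻ Δ (length es * 3) (λ Δ′ → Δ ⊑ Δ′ × AllKnown Δ′ ×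
                      (∀ C → C ∈ concatMap extClauses es → Has Δ′ C))
  add-definitions [] _ _ _ known _ = pure ((λ _ i → i) , known , λ _ ())
  add-definitions {Λ} {Δ} {e@(x , p , q) ∷ es} valid@(ext fresh x≢p x≢q cl v) sub Γ⊑Λ Γ⊑Δ known guarded =
    add-definition (sub (here refl)) freshΓ x≢p x≢q cl Γ⊑Δ (guarded (here refl)) known
    >>= λ {Δ₁} Δ⊑Δ₁ (_ , known₁ , has₁ , new₁) →
    Reach-map (λ {Δ₂} Δ₁⊑Δ₂ (_ , known₂ , has₂) →
        (λ C i → Δ₁⊑Δ₂ C (Δ⊑Δ₁ C i)) , known₂ , λ C i → combine has₁ has₂ Δ₁⊑Δ₂ (∈-++⁻ (extClauses e) i))
      (add-definitions v (λ i → sub (there i)) (λ C i → ∈-++⁺ˡ (Γ⊑Λ C i)) (λ C i → Δ⊑Δ₁ C (Γ⊑Δ C i)) known₁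
        (λ i → guarded′ i new₁))
    where
    freshΓ : ¬ Occurs x Γ
    freshΓ (D , D∈ , o) = fresh (D , Γ⊑Λ D D∈ , o)
    guarded′ : ∀ {Δ₁ e′} → e′ ∈ es →
               (∀ D → D ∈ Δ₁ → D ∈ Δ ⊎ (∃ λ E → E ∈ extClauses e × D ≡ reduct E)) → Guarded Δ₁ (proj₁ e′)
    guarded′ i new D D∈ l l∈ v≡ with new D D∈
    ... | inj₁ j = guarded (there i) D j l l∈ v≡
    ... | inj₂ (E , E∈ , refl) = ⊥-elim (ValidExt-fresh v i (E , ∈-++⁺ʳ Λ E∈ , l , reduct⊑ E l l∈ , v≡))
    combine : ∀ {Δ₁ Δ₂ C} → (∀ C → C ∈ extClauses e → Has Δ₁ C) → (∀ C → C ∈ concatMap extClauses es → Has Δ₂ C) →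
              Δ₁ ⊑ Δ₂ → C ∈ extClauses e ⊎ C ∈ concatMap extClauses es → Has Δ₂ C
    combine has₁ has₂ s (inj₁ i) = Has-mono s (has₁ _ i)
    combine has₁ has₂ s (inj₂ i) = has₂ _ i

  RAT⁻-simulates-ER : ∃ λ N → N ≤ erSize π × RAT⁻Proof G N
  RAT⁻-simulates-ER with add-definitions {Δ = G} valid (λ i → i) (λ _ i → i) (λ _ i → ∈-𝒢⁺ π i)
                           (λ D D∈ l l∈ → D , D∈ , l , l∈ , refl) guarded
    where
    -- By freshness an extension variable occurs in `G` only as the literal put in front of a clause
    -- of Γ.
    guarded : ∀ {e} → e ∈ exts → Guarded G (proj₁ e)
    guarded {e} e∈ D D∈ l l∈ v with ∈-𝒢⁻ π D∈
    ... | inj₁ i = ⊥-elim (ValidExt-fresh valid e∈ (D , i , l , l∈ , v))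
    ... | inj₂ (_ , _ , l₁ , _ , D₀ , D₀∈ , refl) =
          D₀ , D₀∈ , λ d i → there i , λ v′ → ValidExt-fresh valid e∈ (D₀ , D₀∈ , d , i , v′)
  ... | Δ , m , m≤ , s , G⊑Δ , known , has
      with simulate-res {Δ = Δ} res (λ D i → all D (∈-++⁻ Γ i)) known
    where
    all : ∀ D → D ∈ Γ ⊎ D ∈ concatMap extClauses exts → Has Δ D
    all D (inj₁ i) = inj₂ (D , G⊑Δ D (∈-𝒢⁺ π i) , λ _ j → j)
    all D (inj₂ i) = has D i
  ... | N , N≤ , p = m + N , +-mono-≤ (≤-trans m≤ (≤-reflexive (*-comm (length exts) 3))) N≤ , Steps-Proof s p

-- Resolution up to subsumption, and derivation trees.

taut? : ∀ C → Dec (Taut C)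
taut? C = map′ to from (any? (λ l → negate l ∈? C) C)
  where
  to : Any (λ l → negate l ∈ C) C → Taut C
  to a = let l , i , j = find a in compl⇒Taut l i j
  from : Taut C → Any (λ l → negate l ∈ C) C
  from (v , i , j) = lose i j

Taut-⊑ : ∀ {C D} → C ⊑ D → Taut C → Taut D
Taut-⊑ s (v , i , j) = v , s _ i , s _ j

-- Clauses are tracked up to subsumption and tautologies are free, so that cuts
-- need no side conditions.
Has : Formula → Clause → Set
Has Γ C = Taut C ⊎ (∃ λ D → D ∈ Γ × D ⊑ C)

Has-mono : ∀ {Γ Δ C} → Γ ⊑ Δ → Has Γ C → Has Δ C
Has-mono s (inj₁ t) = inj₁ t
Has-mono s (inj₂ (D , i , h)) = inj₂ (D , s D i , h)

Has-⊑ : ∀ {Γ C D} → C ⊑ D → Has Γ C → Has Γ D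
Has-⊑ s (inj₁ t) = inj₁ (Taut-⊑ s t)
Has-⊑ s (inj₂ (E , i , h)) = inj₂ (E , i , λ a j → s a (h a j))

∷-⊑ : ∀ {l : Lit} {C} → l ∈ C → l ∷ C ⊑ C
∷-⊑ i _ (here refl) = i
∷-⊑ i _ (there j) = j

⊑-strengthen : ∀ {l : Lit} {C D} → l ∉ D → D ⊑ l ∷ C → D ⊑ C
⊑-strengthen n s a i with s a i
... | here refl = ⊥-elim (n i)
... | there j = j

∷-mono : ∀ {l : Lit} {C D} → C ⊑ D → l ∷ C ⊑ l ∷ D
∷-mono s _ (here e) = here e
∷-mono s _ (there i) = there (s _ i)

IsClause-∷ : ∀ {l C} → IsClause C → negate l ∉ C → IsClause (l ∷ C)
IsClause-∷ c n (v , here refl , there j) = n j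
IsClause-∷ c n (v , there i , here refl) = n i
IsClause-∷ c n (v , there i , there j) = c (v , i , j)

-- A resolution step is made only if `C` is a proper clause without the cut variable and both
-- subsuming clauses contain it; otherwise `C` is available already.
Has-cut : ∀ {Γ} l C → Has Γ (l ∷ C) → Has Γ (negate l ∷ C) → Reach ResRule Γ 1 (λ Δ → Has Δ C)
Has-cut {Γ} l C h₁ h₂ with taut? C | l ∈? C | negate l ∈? C
... | yes t | _ | _ = pure (inj₁ t)
... | no _ | yes i | _ = pure (Has-⊑ (∷-⊑ i) h₁)
... | no _ | no _ | yes j = pure (Has-⊑ (∷-⊑ j) h₂)
... | no ¬t | no l∉ | no l̄∉ with h₁ | h₂
...   | inj₁ t | _ = ⊥-elim (IsClause-∷ ¬t l̄∉ t)
...   | inj₂ _ | inj₁ t = ⊥-elim (IsClause-∷ ¬t (λ i → l∉ (subst (_∈ C) (negate-negate l) i)) t)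
...   | inj₂ (D , D∈ , D⊑) | inj₂ (E , E∈ , E⊑) with l ∈? D | negate l ∈? E
...     | no n | _ = pure (inj₂ (D , D∈ , ⊑-strengthen n D⊑))
...     | yes _ | no n = pure (inj₂ (E , E∈ , ⊑-strengthen n E⊑))
...     | yes i | yes j = R ∷ Γ , 1 , ≤-refl ,
            step (inj₁ (resolve l D∈ E∈ i j (IsClause-⊑ R⊑C ¬t))) stop , inj₂ (R , here refl , R⊑C)
  where
  R : Clause
  R = remove l D ++ remove (negate l) E
  R⊑C : R ⊑ C
  R⊑C a k with ∈-++⁻ (remove l D) k
  ... | inj₁ m with ∈-remove⁻ {l} {a} {D} m
  ...   | b , n with D⊑ a b
  ...     | here e = ⊥-elim (n e)
  ...     | there c = c
  R⊑C a k | inj₂ m with ∈-remove⁻ {negate l} {a} {E} m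
  ...   | b , n with E⊑ a b
  ...     | here e = ⊥-elim (n e)
  ...     | there c = c

-- Derivations by cuts from a fixed `Γ`, indexed by the exact number of cuts. Weakening is hidden in
-- the leaves, whence `Tree-⊑`.
data Tree (Γ : Formula) : ℕ → Clause → Set where
  leaf : ∀ {C} → Has Γ C → Tree Γ 0 C
  cut  : ∀ {a b C} l → Tree Γ a (l ∷ C) → Tree Γ b (negate l ∷ C) → Tree Γ (suc (a + b)) C

Tree-≡ : ∀ {Γ m n C} → m ≡ n → Tree Γ m C → Tree Γ n C
Tree-≡ refl t = t

Tree-⊑ : ∀ {Γ n C D} → C ⊑ D → Tree Γ n C → Tree Γ n D
Tree-⊑ s (leaf h)    = leaf (Has-⊑ s h)
Tree-⊑ s (cut l t u) = cut l (Tree-⊑ (∷-mono s) t) (Tree-⊑ (∷-mono s) u)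

derive : ∀ {Γ Δ n C} → Γ ⊑ Δ → Tree Γ n C → Reach ResRule Δ n (λ Λ → Has Λ C)
derive s (leaf h) = pure (Has-mono s h)
derive s (cut {a} {b} {C} l t u) = weaken (≤-reflexive (trans (cong (a +_) (+-comm b 1)) (+-suc a b)))
  (derive s t >>= λ s₁ h → derive (λ D i → s₁ D (s D i)) u >>= λ s₂ h′ → Has-cut l C (Has-mono s₂ h) h′)

leaf-∈ : ∀ {Γ C D} → C ∈ Γ → C ⊑ D → Tree Γ 0 D
leaf-∈ i s = leaf (inj₂ (_ , i , s))

leaf-compl : ∀ {Γ C} l → l ∈ C → negate l ∈ C → Tree Γ 0 C
leaf-compl l i j = leaf (inj₁ (compl⇒Taut l i j))

-- Case distinction over the disjunction `ls`: each literal costs one cut and its tree.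
cut-all : ∀ {Γ a b C} ls → Tree Γ a (ls ++ C) → (∀ l → l ∈ ls → Tree Γ b (negate l ∷ C)) →
          Tree Γ (length ls * suc b + a) C
cut-all [] t _ = t
cut-all {Γ} {a} {b} {C} (l ∷ ls) t u = Tree-≡ (count (length ls * suc b) a b)
  (cut l (cut-all ls (Tree-⊑ move t) (λ l′ i → Tree-⊑ widen (u l′ (there i)))) (u l (here refl)))
  where
  count : ∀ x a b → suc (x + a + b) ≡ suc b + x + a
  count = solve-∀
  move : l ∷ ls ++ C ⊑ ls ++ l ∷ C
  move _ (here refl) = ∈-++⁺ʳ ls (here refl)
  move _ (there i) with ∈-++⁻ ls i
  ... | inj₁ j = ∈-++⁺ˡ j
  ... | inj₂ j = ∈-++⁺ʳ ls (there j)
  widen : ∀ {l′} → negate l′ ∷ C ⊑ negate l′ ∷ l ∷ C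
  widen _ (here e) = here e
  widen _ (there i) = there (there i)

-- Monotonicity carries what was derived for earlier indices into the formulas grown for later ones.
Reach-all : ∀ {R Γ} n c (P : ℕ → Formula → Set) → (∀ {i Δ Λ} → Δ ⊑ Λ → P i Δ → P i Λ) →
            (∀ i → i < n → ∀ {Δ} → Γ ⊑ Δ → Reach R Δ c (P i)) →
            Reach R Γ (n * c) (λ Δ → ∀ i → i < n → P i Δ)
Reach-all zero c P mono f = pure λ _ ()
Reach-all {R} {Γ} (suc n) c P mono f =
  weaken (≤-reflexive (+-comm (n * c) c))
    (Reach-all n c P mono (λ i i<n → f i (m<n⇒m<1+n i<n)) >>= λ s all →
     Reach-map (λ s′ p i i<1+n → pick s′ all p i (m≤n⇒m<n∨m≡n (s≤s⁻¹ i<1+n))) (f n ≤-refl s))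
  where
  pick : ∀ {Δ Λ} → Δ ⊑ Λ → (∀ i → i < n → P i Δ) → P n Λ → ∀ i → i < n ⊎ i ≡ n → P i Λ
  pick s all p i (inj₁ i<n)  = mono s (all i i<n)
  pick s all p i (inj₂ refl) = p

-- Numbered extension variables, conjunction chains and case analysis over bits.

-- Consecutive numbering from `B` turns freshness into an inequality; `p ≢ negate q` keeps the
-- ternary extension clause from being tautological.
data Ordered : ℕ → List ExtTriple → ℕ → Set where
  []  : ∀ {B} → Ordered B [] B
  def : ∀ {B B′ p q es} → var p < B → var q < B → p ≢ negate q →
        Ordered (suc B) es B′ → Ordered B ((B , p , q) ∷ es) B′

Ordered-++ : ∀ {A B C es fs} → Ordered A es B → Ordered B fs C → Ordered A (es ++ fs) C
Ordered-++ [] o = o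
Ordered-++ (def a b c o) o′ = def a b c (Ordered-++ o o′)

Ordered-ValidExt : ∀ {B B′ es Δ} → Ordered B es B′ → (∀ {v} → Occurs v Δ → v < B) → ValidExt Δ es
Ordered-ValidExt [] _ = []
Ordered-ValidExt {B} {Δ = Δ} (def {p = p} {q} p<B q<B p≢q̄ o) bound =
  ext (λ o → n≮n B (bound o)) (λ e → <⇒≢ p<B (sym e)) (λ e → <⇒≢ q<B (sym e)) clause
      (Ordered-ValidExt o bound′)
  where
  small : ∀ {r} → var r < B → pos B ≢ r × neg B ≢ r
  small h = (λ { refl → <-irrefl refl h }) , (λ { refl → <-irrefl refl h })
  clause : IsClause (pos B ∷ negate p ∷ negate q ∷ [])
  clause (v , i , j) = clash (pos v) i j
    where
    p̄<B = subst (_< B) (sym (var-negate p)) p<B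
    q̄<B = subst (_< B) (sym (var-negate q)) q<B
    clash : ∀ l → l ∈ pos B ∷ negate p ∷ negate q ∷ [] → negate l ∈ pos B ∷ negate p ∷ negate q ∷ [] → ⊥
    clash l (here refl) (there (here e)) = proj₂ (small p̄<B) e
    clash l (here refl) (there (there (here e))) = proj₂ (small q̄<B) e
    clash l (there (here refl)) (here e) = proj₁ (small p<B) (trans (sym e) (negate-negate p))
    clash l (there (here refl)) (there (here e)) = negate≢ _ e
    clash l (there (here refl)) (there (there (here e))) = p≢q̄ (trans (sym (negate-negate p)) e)
    clash l (there (there (here refl))) (here e) = proj₁ (small q<B) (trans (sym e) (negate-negate q))
    clash l (there (there (here refl))) (there (here e)) = p≢q̄ (trans (sym (negate-negate p)) (cong negate (trans (sym e) (negate-negate q))))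
    clash l (there (there (here refl))) (there (there (here e))) = negate≢ _ e
  bound′ : ∀ {v} → Occurs v (Δ ++ extClauses (B , p , q)) → v < suc B
  bound′ (D , D∈ , l , l∈ , refl) with ∈-++⁻ Δ D∈
  ... | inj₁ i = m<n⇒m<1+n (bound (D , i , l , l∈ , refl))
  ... | inj₂ i = new i l∈
    where
    p< = m<n⇒m<1+n p<B
    q< = m<n⇒m<1+n q<B
    new : ∀ {D l} → D ∈ extClauses (B , p , q) → l ∈ D → var l < suc B
    new (here refl) (here refl) = ≤-refl
    new (here refl) (there (here refl)) = p<
    new (there (here refl)) (here refl) = ≤-refl
    new (there (here refl)) (there (here refl)) = q<
    new (there (there (here refl))) (here refl) = ≤-refl
    new (there (there (here refl))) (there (here refl)) = subst (_< suc B) (sym (var-negate p)) p<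
    new (there (there (here refl))) (there (there (here refl))) = subst (_< suc B) (sym (var-negate q)) q<

blocks : (ℕ → List ExtTriple) → ℕ → List ExtTriple
blocks f zero    = []
blocks f (suc n) = blocks f n ++ f n

∈-blocks : ∀ {f n t e} → t < n → e ∈ f t → e ∈ blocks f n
∈-blocks {f} {suc n} {t} t<n i with m≤n⇒m<n∨m≡n (s≤s⁻¹ t<n)
... | inj₁ t<n′ = ∈-++⁺ˡ (∈-blocks t<n′ i)
... | inj₂ refl = ∈-++⁺ʳ (blocks f n) i

Ordered-blocks : ∀ {f B w} n → (∀ t → t < n → Ordered (B + t * w) (f t) (B + suc t * w)) →
                 Ordered B (blocks f n) (B + n * w)
Ordered-blocks {B = B} zero h = subst (Ordered B []) (sym (+-identityʳ B)) []
Ordered-blocks (suc n) h = Ordered-++ (Ordered-blocks n (λ t t<n → h t (m<n⇒m<1+n t<n))) (h n ≤-refl)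

length-blocks : ∀ {f w} n → (∀ t → length (f t) ≡ w) → length (blocks f n) ≡ n * w
length-blocks zero h = refl
length-blocks {f} {w} (suc n) h = trans (length-++ (blocks f n))
  (trans (cong₂ _+_ (length-blocks n h) (h n)) (+-comm (n * w) w))

-- Binary gates for the conjunction of `p` and all of `ls`, whose value is the literal `chainOut`.
chain : ℕ → Lit → List Lit → List ExtTriple
chain B p []       = []
chain B p (l ∷ ls) = (B , p , l) ∷ chain (suc B) (pos B) ls

chainOut : ℕ → Lit → List Lit → Lit
chainOut B p []       = p
chainOut B p (l ∷ ls) = chainOut (suc B) (pos B) ls

length-chain : ∀ B p ls → length (chain B p ls) ≡ length ls
length-chain B p []       = refl
length-chain B p (l ∷ ls) = cong suc (length-chain (suc B) (pos B) ls)

chainOut-∷ : ∀ B p l ls → chainOut B p (l ∷ ls) ≡ pos (B + length ls)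
chainOut-∷ B p l []        = cong pos (sym (+-identityʳ B))
chainOut-∷ B p l (l′ ∷ ls) = trans (chainOut-∷ (suc B) (pos B) l′ ls) (cong pos (sym (+-suc B (length ls))))

chainOut-length : ∀ B p ls {n} → length ls ≡ suc n → chainOut B p ls ≡ pos (B + n)
chainOut-length B p (l ∷ ls) refl = chainOut-∷ B p l ls

Ordered-chain : ∀ {A B} p ls → A ≤ B → var p < B → (∀ {l} → l ∈ ls → var l < A) →
                (∀ {l} → l ∈ ls → p ≢ negate l) → Ordered B (chain B p ls) (B + length ls)
Ordered-chain {B = B} p [] _ _ _ _ = subst (Ordered B []) (sym (+-identityʳ B)) []
Ordered-chain {A} {B} p (l ∷ ls) A≤B p<B h n =
  def p<B (≤-trans (h (here refl)) A≤B) (n (here refl))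
    (subst (Ordered (suc B) _) (sym (+-suc B (length ls)))
      (Ordered-chain (pos B) ls (m≤n⇒m≤1+n A≤B) ≤-refl (λ i → h (there i))
        (λ {l′} i e → <⇒≢ (≤-trans (h (there i)) A≤B) (trans (sym (var-negate l′)) (sym (cong var e))))))

Defines : Formula → List ExtTriple → Set
Defines Γ es = ∀ {e C} → e ∈ es → C ∈ extClauses e → C ∈ Γ

chain-prev : ∀ {Γ} B p ls → Defines Γ (chain B p ls) →
             Tree Γ (length ls) (negate (chainOut B p ls) ∷ p ∷ [])
chain-prev B p [] d = leaf-compl p (there (here refl)) (here refl)
chain-prev {Γ} B p (l ∷ ls) d = Tree-≡ (cong suc (+-identityʳ _))
  (cut (pos B) (Tree-⊑ s (chain-prev (suc B) (pos B) ls (λ i → d (there i))))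
       (leaf-∈ (d (here refl) (here refl)) (λ { _ (here e) → here e ; _ (there (here e)) → there (there (here e)) })))
  where
  s : ∀ {a} → a ∷ pos B ∷ [] ⊑ pos B ∷ a ∷ p ∷ []
  s _ (here e) = there (here e)
  s _ (there (here e)) = here e

chain-each : ∀ {Γ a} B p ls → Defines Γ (chain B p ls) → a ∈ ls →
             Tree Γ (length ls) (negate (chainOut B p ls) ∷ a ∷ [])
chain-each {Γ} B p (l ∷ ls) d (here refl) = Tree-≡ (cong suc (+-identityʳ _))
  (cut (pos B) (Tree-⊑ s (chain-prev (suc B) (pos B) ls (λ i → d (there i))))
       (leaf-∈ (d (here refl) (there (here refl))) (λ { _ (here e) → here e ; _ (there (here e)) → there (there (here e)) })))
  where
  s : ∀ {a} → a ∷ pos B ∷ [] ⊑ pos B ∷ a ∷ l ∷ []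
  s _ (here e) = there (here e)
  s _ (there (here e)) = here e
chain-each {Γ} {a} B p (l ∷ ls) d (there i) = Tree-≡ (cong suc (+-identityʳ _))
  -- A cut against a tautology, which pads the count because the index of `Tree` is exact.
  (cut l₀ (Tree-⊑ (λ _ → there) (chain-each (suc B) (pos B) ls (λ i → d (there i)) i))
       (leaf-compl l₀ (there (here refl)) (here refl)))
  where l₀ = negate (chainOut (suc B) (pos B) ls)

chain-all : ∀ {Γ} B p ls → Defines Γ (chain B p ls) →
            Tree Γ (length ls) (chainOut B p ls ∷ negate p ∷ map negate ls)
chain-all B p [] d = leaf-compl p (here refl) (there (here refl))
chain-all {Γ} B p (l ∷ ls) d = 
  cut (pos B) (leaf-∈ (d (here refl) (there (there (here refl)))) s)
      (Tree-⊑ s′ (chain-all (suc B) (pos B) ls (λ i → d (there i))))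
  where
  s : ∀ {a} → pos B ∷ negate p ∷ negate l ∷ [] ⊑ pos B ∷ a ∷ negate p ∷ negate l ∷ map negate ls
  s _ (here e) = here e
  s _ (there (here e)) = there (there (here e))
  s _ (there (there (here e))) = there (there (there (here e)))
  s′ : ∀ {a} → a ∷ neg B ∷ map negate ls ⊑ neg B ∷ a ∷ negate p ∷ negate l ∷ map negate ls
  s′ _ (here e) = there (here e)
  s′ _ (there (here e)) = here e
  s′ _ (there (there i)) = there (there (there (there i)))

nth : {A : Set} → A → List A → ℕ → A
nth d []       _       = d
nth d (x ∷ xs) zero    = x
nth d (x ∷ xs) (suc i) = nth d xs i

∈⇒nth : ∀ {A : Set} {d x : A} {xs} → x ∈ xs → ∃ λ i → i < length xs × nth d xs i ≡ x
∈⇒nth (here refl) = 0 , s≤s z≤n , refl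
∈⇒nth (there i) = let j , j< , e = ∈⇒nth i in suc j , s≤s j< , e

module _ {A : Set} {x : A} where
  ∈0 : ∀ {xs} → x ∈ x ∷ xs
  ∈0 = here refl
  ∈1 : ∀ {a xs} → x ∈ a ∷ x ∷ xs
  ∈1 = there ∈0
  ∈2 : ∀ {a b xs} → x ∈ a ∷ b ∷ x ∷ xs
  ∈2 = there ∈1
  ∈3 : ∀ {a b c xs} → x ∈ a ∷ b ∷ c ∷ x ∷ xs
  ∈3 = there ∈2
  ∈4 : ∀ {a b c d xs} → x ∈ a ∷ b ∷ c ∷ d ∷ x ∷ xs
  ∈4 = there ∈3

⊑-2 : ∀ {a b : Lit} {D} → a ∈ D → b ∈ D → a ∷ b ∷ [] ⊑ D
⊑-2 i j _ (here refl) = i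
⊑-2 i j _ (there (here refl)) = j

⊑-3 : ∀ {a b c : Lit} {D} → a ∈ D → b ∈ D → c ∈ D → a ∷ b ∷ c ∷ [] ⊑ D
⊑-3 i j k _ (here refl) = i
⊑-3 i j k _ (there h) = ⊑-2 j k _ h

neqs : ∀ {k} → (Fin k → ℕ) → Vec Bool k → Clause
neqs {k} v h = map (λ ℓ → neqLit (v ℓ) (lookup h ℓ)) (allFin k)

∈-neqs⁺ : ∀ {k} (v : Fin k → ℕ) h ℓ → neqLit (v ℓ) (lookup h ℓ) ∈ neqs v h
∈-neqs⁺ v h ℓ = ∈-map⁺ _ (∈-allFin ℓ)

∈-neqs⁻ : ∀ {k} (v : Fin k → ℕ) h {l} → l ∈ neqs v h → ∃ λ ℓ → l ≡ neqLit (v ℓ) (lookup h ℓ)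
∈-neqs⁻ v h i = let ℓ , _ , e = ∈-map⁻ _ i in ℓ , e

-- The cuts of a complete binary tree querying k bits, with `b` further cuts at each of its 2^k
-- leaves.
bitsCost : ℕ → ℕ → ℕ
bitsCost zero    b = b
bitsCost (suc k) b = suc (bitsCost k b + bitsCost k b)

bitsCost-≤ : ∀ k b → suc (bitsCost k b) ≡ 2 ^ k * suc b
bitsCost-≤ zero b = sym (+-identityʳ (suc b))
bitsCost-≤ (suc k) b = begin
  suc (suc (c + c))                  ≡⟨ cong suc (+-suc c c) ⟨
  suc c + suc c                      ≡⟨ cong₂ _+_ (bitsCost-≤ k b) (bitsCost-≤ k b) ⟩
  2 ^ k * suc b + 2 ^ k * suc b      ≡⟨ cong (2 ^ k * suc b +_) (+-identityʳ _) ⟨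
  2 * (2 ^ k * suc b)                ≡⟨ *-assoc 2 (2 ^ k) (suc b) ⟨
  2 ^ suc k * suc b                  ∎
  where
  open ≡-Reasoning
  c = bitsCost k b

bits-tree : ∀ {Γ b} k (v : Fin k → ℕ) C → (∀ h → Tree Γ b (neqs v h ++ C)) → Tree Γ (bitsCost k b) C
bits-tree zero v C f = f []ᵥ
bits-tree {Γ} {b} (suc k) v C f = cut (pos (v zero)) (branch false) (branch true)
  where
  branch : ∀ β → Tree Γ (bitsCost k b) (neqLit (v zero) β ∷ C)
  branch β = bits-tree k (v ∘ suc) (neqLit (v zero) β ∷ C) λ h → Tree-⊑ (move h) (f (β ∷ᵥ h))
    where
    move : ∀ h → neqs v (β ∷ᵥ h) ++ C ⊑ neqs (v ∘ suc) h ++ neqLit (v zero) β ∷ C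
    move h l i with ∈-++⁻ (neqs v (β ∷ᵥ h)) i
    ... | inj₂ j = ∈-++⁺ʳ (neqs (v ∘ suc) h) (there j)
    ... | inj₁ j with ∈-neqs⁻ v (β ∷ᵥ h) j
    ...   | zero , refl = ∈-++⁺ʳ (neqs (v ∘ suc) h) (here refl)
    ...   | suc ℓ , refl = ∈-++⁺ˡ (∈-neqs⁺ (v ∘ suc) h ℓ)

-- q x i plays the role of the unary variable "pigeon x sits in hole i".
record Level (r : ℕ) (q : ℕ → ℕ → Lit) (Δ : Formula) : Set where
  field
    total     : ∀ x → x < suc r → Has Δ (map (q x) (upTo r))
    injective : ∀ x → x < suc r → ∀ y → y < suc r → ∀ i → i < r → x ≢ y →
                Has Δ (negate (q x i) ∷ negate (q y i) ∷ [])

-- Cook's polynomial ER refutation.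

module Cook (k′ : ℕ) where
  k m M grid : ℕ
  k = suc k′
  m = 2 ^ k
  M = suc m
  grid = M * m

  instance
    m≢0 : NonZero m
    m≢0 = m^n≢0 2 k

  open Bits k hiding (M)

  index : ℕ → ℕ → ℕ
  index x i = x * m + i

  index< : ∀ {x i} → x < M → i < m → index x i < grid
  index< {x} {i} x<M i<m = begin-strict
    x * m + i   <⟨ +-monoʳ-< (x * m) i<m ⟩
    x * m + m   ≡⟨ +-comm (x * m) m ⟩
    suc x * m   ≤⟨ *-monoˡ-≤ m x<M ⟩
    M * m       ∎
    where open ≤-Reasoning

  index-% : ∀ x {i} → i < m → index x i % m ≡ i
  index-% x {i} i<m = trans (cong (_% m) (+-comm (x * m) i)) (trans ([m+kn]%n≡m%n i x m) (m<n⇒m%n≡m i<m))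

  index-/ : ∀ x {i} → i < m → index x i / m ≡ x
  index-/ x {i} i<m = *-cancelʳ-≡ _ _ m (+-cancelˡ-≡ i _ _ (begin
    i + index x i / m * m               ≡⟨ cong (_+ index x i / m * m) (index-% x i<m) ⟨
    index x i % m + index x i / m * m   ≡⟨ m≡m%n+[m/n]*n (index x i) m ⟨
    x * m + i                           ≡⟨ +-comm (x * m) i ⟩
    i + x * m                           ∎))
    where open ≡-Reasoning

  -- Extension gates are conjunctions, so the disjunction of `q x i` with the gate a is had by
  -- defining its negation; this accounts for the `neg` and for the odd offset, the second gate of
  -- the cell.
  next : ℕ → ℕ → ℕ → Lit
  next B x i = neg (suc (B + index x i * 2))

  Bounded : (ℕ → ℕ → Lit) → ℕ → Set
  Bounded q B = ∀ x i → x < M → i < m → var (q x i) < B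

  -- Keeps a gate from joining complementary literals. Each level has a single polarity: positive
  -- for `unary`, negative for `next`.
  Coherent : (ℕ → ℕ → Lit) → Set
  Coherent q = ∀ x i y j → q x i ≢ negate (q y j)

  -- Cook's reduction from holes 0..r to holes 0..r-1: pigeon x moves to hole i if it was there
  -- or if it was in hole r and the last pigeon suc r was in hole i.
  reduction : ℕ → ℕ → (ℕ → ℕ → Lit) → ℕ → List ExtTriple
  reduction r B q t = (a , q x r , q (suc r) i) ∷ (suc a , negate (q x i) , neg a) ∷ []
    where
    a = B + t * 2
    x = t / m
    i = t % m

  levels : ℕ → ℕ → (ℕ → ℕ → Lit) → List ExtTriple
  levels zero    B q = []
  levels (suc r) B q = blocks (reduction r B q) grid ++ levels r (B + grid * 2) (next B)

  next-Bounded : ∀ B → Bounded (next B) (B + grid * 2)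
  next-Bounded B x i x<M i<m = begin-strict
    suc (B + t * 2)          <⟨ ≤-refl ⟩
    suc (suc (B + t * 2))    ≡⟨ two B (t * 2) ⟩
    B + suc t * 2            ≤⟨ +-monoʳ-≤ B (*-monoˡ-≤ 2 (index< x<M i<m)) ⟩
    B + grid * 2             ∎
    where
    open ≤-Reasoning
    t = index x i
    two : ∀ a b → suc (suc (a + b)) ≡ a + suc (suc b)
    two = solve-∀

  Ordered-reduction : ∀ {r B q} → r < m → Bounded q B → Coherent q → ∀ t → t < grid →
                      Ordered (B + t * 2) (reduction r B q t) (B + suc t * 2)
  Ordered-reduction {r} {B} {q} r<m bounded coherent t t< =
    def (bound x r x<M r<m) (bound (suc r) i (s≤s r<m) i<m) (coherent _ _ _ _)
      (def (m<n⇒m<1+n (subst (_< a) (sym (var-negate (q x i))) (bound x i x<M i<m))) ≤-refl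
           (λ e → <⇒≢ (bound x i x<M i<m) (trans (sym (var-negate (q x i))) (cong var e)))
           (subst (Ordered (suc (suc a)) []) (two B (t * 2)) []))
    where
    a = B + t * 2
    x = t / m
    i = t % m
    x<M : x < M
    x<M = m<n*o⇒m/o<n t<
    i<m : i < m
    i<m = m%n<n t m
    bound : ∀ x i → x < M → i < m → var (q x i) < a
    bound x i p s = ≤-trans (bounded x i p s) (m≤m+n B _)
    two : ∀ a b → suc (suc (a + b)) ≡ a + suc (suc b)
    two = solve-∀

  Ordered-levels : ∀ r {B q} → r ≤ m → Bounded q B → Coherent q → ∃ λ B′ → Ordered B (levels r B q) B′
  Ordered-levels zero _ _ _ = _ , []
  Ordered-levels (suc r) {B} r<m bounded coherent =
    let B′ , o = Ordered-levels r (<⇒≤ r<m) (next-Bounded B) (λ _ _ _ _ ())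
    in B′ , Ordered-++ (Ordered-blocks grid (Ordered-reduction r<m bounded coherent)) o

  length-levels : ∀ r B q → length (levels r B q) ≡ r * (grid * 2)
  length-levels zero B q = refl
  length-levels (suc r) B q = trans (length-++ (blocks (reduction r B q) grid))
    (cong₂ _+_ (length-blocks grid (λ _ → refl)) (length-levels r _ _))

  module _ {r B q Γ} (r<m : r < m) (d : Defines Γ (blocks (reduction r B q) grid)) (L : Level (suc r) q Γ) where
    open Level L

    module Cell {x i} (x<M : x < M) (i<m : i < m) where
      a z : ℕ
      a = B + index x i * 2
      z = suc a

      first : (a , q x r , q (suc r) i) ∈ blocks (reduction r B q) grid
      first = ∈-blocks (index< x<M i<m) (here (cong₂ (λ u w → a , q u r , q (suc r) w) (sym (index-/ x i<m)) (sym (index-% x i<m))))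

      second : (z , negate (q x i) , neg a) ∈ blocks (reduction r B q) grid
      second = ∈-blocks (index< x<M i<m) (there (here (cong₂ (λ u w → z , negate (q u w) , neg a) (sym (index-/ x i<m)) (sym (index-% x i<m)))))

      a⇒qr : ∀ {C} → neg a ∈ C → q x r ∈ C → Tree Γ 0 C
      a⇒qr s t = leaf-∈ (d first ∈0) (⊑-2 s t)
      a⇒g : ∀ {C} → neg a ∈ C → q (suc r) i ∈ C → Tree Γ 0 C
      a⇒g s t = leaf-∈ (d first ∈1) (⊑-2 s t)
      ⇒a : ∀ {C} → pos a ∈ C → negate (q x r) ∈ C → negate (q (suc r) i) ∈ C → Tree Γ 0 C
      ⇒a s t u = leaf-∈ (d first ∈2) (⊑-3 s t u)
      q⇒next : ∀ {C} → neg z ∈ C → negate (q x i) ∈ C → Tree Γ 0 C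
      q⇒next s t = leaf-∈ (d second ∈0) (⊑-2 s t)
      a⇒next : ∀ {C} → neg z ∈ C → neg a ∈ C → Tree Γ 0 C
      a⇒next s t = leaf-∈ (d second ∈1) (⊑-2 s t)
      next⇒ : ∀ {C} → pos z ∈ C → q x i ∈ C → pos a ∈ C → Tree Γ 0 C
      next⇒ {C} s t u = leaf-∈ (d second ∈2) (⊑-3 s (subst (_∈ C) (sym (negate-negate (q x i))) t) u)

    inj-leaf : ∀ {x y i C} → x < suc (suc r) → y < suc (suc r) → i < suc r → x ≢ y →
               negate (q x i) ∈ C → negate (q y i) ∈ C → Tree Γ 0 C
    inj-leaf x< y< i< n s t = leaf (Has-⊑ (⊑-2 s t) (injective _ x< _ y< _ i< n))

    -- Cases by how x and y got to hole i. Both were there, or both moved out of hole r, or one was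
    -- there and the other moved because the last pigeon was there as well. Each contradicts
    -- injectivity one level up.
    inj-tree : ∀ x → x < suc r → ∀ y → y < suc r → ∀ i → i < r → x ≢ y →
               Tree Γ 10 (negate (next B x i) ∷ negate (next B y i) ∷ [])
    inj-tree x x≤r y y≤r i i<r x≢y =
      cut qx
        (cut (pos X.a) (X.next⇒ ∈2 ∈1 ∈0)
          (cut qy
            (cut (pos Y.a) (Y.next⇒ (there ∈4) ∈1 ∈0)
              (cut (q x r) (X.a⇒qr ∈3 ∈0)
                (cut (q y r) (Y.a⇒qr ∈2 ∈0)
                  (inj-leaf x< y< ≤-refl x≢y ∈1 ∈0))))
            (cut g (X.a⇒g ∈2 ∈0) (inj-leaf y< ≤-refl i<1+r y≢last ∈1 ∈0))))
        (cut qy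
          (cut (pos Y.a) (Y.next⇒ ∈4 ∈1 ∈0)
            (cut g (Y.a⇒g ∈1 ∈0) (inj-leaf x< ≤-refl i<1+r x≢last ∈3 ∈0)))
          (inj-leaf x< y< i<1+r x≢y ∈1 ∈0))
      where
      x< = m<n⇒m<1+n x≤r
      y< = m<n⇒m<1+n y≤r
      i<1+r = m<n⇒m<1+n i<r
      x≢last = <⇒≢ x≤r
      y≢last = <⇒≢ y≤r
      i<m = <-trans i<r r<m
      inM : ∀ {z} → z < suc r → z < M
      inM p = m<n⇒m<1+n (≤-trans p r<m)
      module X = Cell {x} {i} (inM x≤r) i<m
      module Y = Cell {y} {i} (inM y≤r) i<m
      qx = q x i
      qy = q y i
      g = q (suc r) i

    upTo-last : ∀ {f : ℕ → Lit} {C} → map f (upTo r) ⊑ C → f r ∈ C → map f (upTo (suc r)) ⊑ C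
    upTo-last {f} s last l j with ∈-map⁻ f j
    ... | i , i∈ , refl with m≤n⇒m<n∨m≡n (s≤s⁻¹ (∈-upTo⁻ i∈))
    ...   | inj₁ i<r  = s _ (∈-map⁺ f (∈-upTo⁺ i<r))
    ...   | inj₂ refl = last

    -- If x is not in hole r, it keeps its hole. Otherwise the last pigeon cannot be in hole r,
    -- hence sits in some i < r, and x moves to that i.
    tot-tree : ∀ x → x < suc r → Tree Γ (3 * r + 2) (map (next B x) (upTo r))
    tot-tree x x≤r = Tree-≡ cost (cut (q x r)
        (cut-all (map (q x) (upTo r)) (leaf (Has-⊑ (upTo-last (λ _ → ∈-++⁺ˡ) (∈-++⁺ʳ (map (q x) (upTo r)) ∈0)) (total x (m<n⇒m<1+n x≤r)))) each₁)
        (cut-all (map (q (suc r)) (upTo r))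
          (cut (q (suc r) r)
            (leaf (Has-⊑ (upTo-last (λ _ i → there (∈-++⁺ˡ i)) ∈0) (total (suc r) ≤-refl)))
            (inj-leaf (m<n⇒m<1+n x≤r) ≤-refl ≤-refl (<⇒≢ x≤r) (there (∈-++⁺ʳ (map (q (suc r)) (upTo r)) ∈0)) ∈0))
          each₂))
      where
      C : Clause
      C = map (next B x) (upTo r)
      x<M : x < M
      x<M = m<n⇒m<1+n (≤-trans x≤r r<m)
      each₁ : ∀ l → l ∈ map (q x) (upTo r) → Tree Γ 0 (negate l ∷ q x r ∷ C)
      each₁ l j with ∈-map⁻ (q x) j
      ... | i , i∈ , refl = Cell.q⇒next x<M (<-trans (∈-upTo⁻ i∈) r<m) (there (there (∈-map⁺ (next B x) i∈))) ∈0
      each₂ : ∀ l → l ∈ map (q (suc r)) (upTo r) → Tree Γ 1 (negate l ∷ negate (q x r) ∷ C)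
      each₂ l j with ∈-map⁻ (q (suc r)) j
      ... | i , i∈ , refl = cut (pos X.a) (X.⇒a ∈0 ∈2 ∈1) (X.a⇒next (there (there (there (∈-map⁺ (next B x) i∈)))) ∈0)
        where module X = Cell {x} {i} x<M (<-trans (∈-upTo⁻ i∈) r<m)
      cost : suc (length (map (q x) (upTo r)) * 1 + 0 + (length (map (q (suc r)) (upTo r)) * 2 + 1)) ≡ 3 * r + 2
      cost rewrite length-map (q x) (upTo r) | length-map (q (suc r)) (upTo r) | length-upTo r = arith r
        where
        arith : ∀ r → suc (r * 1 + 0 + (r * 2 + 1)) ≡ 3 * r + 2
        arith = solve-∀

    level-step : Reach ResRule Γ (suc r * (3 * r + 2) + suc r * (suc r * (r * 10))) (Level r (next B))
    level-step =
      Reach-all (suc r) (3 * r + 2) (λ x Δ → Has Δ (map (next B x) (upTo r))) (λ s → Has-mono s)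
        (λ x x≤r s → derive s (tot-tree x x≤r)) >>= λ s₁ tot →
      Reach-map (λ s₂ inj → record { total = λ x p → Has-mono s₂ (tot x p) ; injective = inj })
        (Reach-all (suc r) (suc r * (r * 10)) _ (λ s f y p i p′ n → Has-mono s (f y p i p′ n)) λ x x≤r s₂ →
         Reach-all (suc r) (r * 10) _ (λ s f i p n → Has-mono s (f i p n)) λ y y≤r s₃ →
         Reach-all r 10 _ (λ s f n → Has-mono s (f n)) λ i i<r s₄ →
           pair x x≤r y y≤r i i<r (λ C j → s₄ C (s₃ C (s₂ C (s₁ C j)))))
      where
      -- `x ≢ y` is moved into the predicate so that `Reach-all` can run over all pairs.
      pair : ∀ x → x < suc r → ∀ y → y < suc r → ∀ i → i < r → ∀ {Δ} → Γ ⊑ Δ →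
             Reach ResRule Δ 10 (λ Λ → x ≢ y → Has Λ (negate (next B x i) ∷ negate (next B y i) ∷ []))
      pair x x≤r y y≤r i i<r s with x ≟ y
      ... | yes e = pure (λ n → ⊥-elim (n e))
      ... | no n = Reach-map (λ _ h _ → h) (derive s (inj-tree x x≤r y y≤r i i<r n))

  levelCost : ℕ
  levelCost = M * (3 * M + 2) + M * (M * (M * 10))

  descend : ∀ r {B q Γ} → r ≤ m → Defines Γ (levels r B q) → Level r q Γ →
            Reach ResRule Γ (r * levelCost) (λ Δ → Has Δ [])
  -- No hole is left, so totality of pigeon 0 is the empty clause.
  descend zero _ _ L = pure (Level.total L 0 ≤-refl)
  descend (suc r) {B} {q} r<m d L =
    weaken (+-monoˡ-≤ (r * levelCost) cheap)
      (level-step r<m (λ i → d (∈-++⁺ˡ i)) L >>= λ s L′ →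
       descend r (<⇒≤ r<m) (λ i j → s _ (d (∈-++⁺ʳ (blocks (reduction r B q) grid) i) j)) L′)
    where
    1+r≤M : suc r ≤ M
    1+r≤M = m≤n⇒m≤1+n r<m
    r≤M : r ≤ M
    r≤M = <⇒≤ 1+r≤M
    cheap : suc r * (3 * r + 2) + suc r * (suc r * (r * 10)) ≤ levelCost
    cheap = +-mono-≤ (*-mono-≤ 1+r≤M (+-monoˡ-≤ 2 (*-monoʳ-≤ 3 r≤M)))
                     (*-mono-≤ 1+r≤M (*-mono-≤ 1+r≤M (*-monoˡ-≤ 10 r≤M)))

  -- From the binary encoding to unary literals.

  hole : ℕ → Hole
  hole = nth (replicate k false) (allVecs k)

  hole-onto : ∀ h → ∃ λ i → i < m × hole i ≡ h
  hole-onto h = let i , i< , e = ∈⇒nth (∈-allVecs h) in i , subst (i <_) (length-allVecs k) i< , e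

  bitLit : ℕ → Hole → Fin k → Lit
  bitLit x h ℓ = negate (neqLit (pvar k x ℓ) (lookup h ℓ))

  litsAt : ℕ → Hole → List Lit
  litsAt x h = map negate (notAt x h)

  B₀ B₁ : ℕ
  B₀ = M * k
  B₁ = B₀ + grid * k

  -- The chain starts from the first bit literal and then lists it again. So each cell has exactly k
  -- gates, and its output is a positive extension variable even for k = 1.
  sits : ℕ → ℕ → List ExtTriple
  sits t x = chain (B₀ + t * k) (bitLit x h zero) (litsAt x h)
    where h = hole (t % m)

  unary : ℕ → ℕ → Lit
  unary x i = chainOut (B₀ + index x i * k) (bitLit x (hole i) zero) (litsAt x (hole i))

  base : ℕ → List ExtTriple
  base t = sits t (t / m)

  length-litsAt : ∀ x h → length (litsAt x h) ≡ k
  length-litsAt x h = trans (length-map negate (notAt x h)) (length-notAt x h)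
    where
    length-notAt : ∀ x h → length (notAt x h) ≡ k
    length-notAt x h = trans (length-map _ (allFin k)) (length-tabulate {n = k} id)

  unary≡ : ∀ x i → unary x i ≡ pos (B₀ + index x i * k + k′)
  unary≡ x i = chainOut-length (B₀ + index x i * k) (bitLit x (hole i) zero) (litsAt x (hole i)) (length-litsAt x (hole i))

  litsAt-true : ∀ x h {l} → l ∈ litsAt x h → litVal h l ≡ true
  litsAt-true x h i with ∈-map⁻ negate i
  ... | l , j , refl = trans (litVal-negate h l) (cong not (proj₂ (∈-notAt⁻ {x} {h} j)))

  bphp-var< : ∀ x h {l} → x < M → l ∈ litsAt x h → var l < B₀
  bphp-var< x h x<M i with ∈-map⁻ negate i
  ... | l , j , refl with ∈-map⁻ (λ ℓ → neqLit (pvar k x ℓ) (lookup h ℓ)) j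
  ...   | ℓ , _ , refl = subst (_< B₀) (sym (trans (var-negate (neqLit (pvar k x ℓ) (lookup h ℓ))) (var-neqLit (lookup h ℓ)))) (begin-strict
      x * k + toℕ ℓ   <⟨ +-monoʳ-< (x * k) (toℕ<n ℓ) ⟩
      x * k + k       ≡⟨ +-comm (x * k) k ⟩
      suc x * k       ≤⟨ *-monoˡ-≤ k x<M ⟩
      M * k           ∎)
    where
    open ≤-Reasoning
    var-neqLit : ∀ {v} b → var (neqLit v b) ≡ v
    var-neqLit true = refl
    var-neqLit false = refl

  Ordered-base : ∀ t → t < grid → Ordered (B₀ + t * k) (base t) (B₀ + suc t * k)
  Ordered-base t t< = subst (Ordered (B₀ + t * k) (base t)) end
    (Ordered-chain (bitLit x h zero) (litsAt x h) (m≤m+n B₀ _)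
      (≤-trans (bphp-var< x h x<M ∈0) (m≤m+n B₀ _)) (λ i → bphp-var< x h x<M i) coherent)
    where
    x = t / m
    h = hole (t % m)
    x<M : x < M
    x<M = m<n*o⇒m/o<n t<
    coherent : ∀ {l} → l ∈ litsAt x h → bitLit x h zero ≢ negate l
    coherent {l} i e with trans (sym (litsAt-true x h (here refl)))
        (trans (cong (litVal h) e) (trans (litVal-negate h l) (cong not (litsAt-true x h i))))
    ... | ()
    end : B₀ + t * k + length (litsAt x h) ≡ B₀ + suc t * k
    end rewrite length-litsAt x h = trans (+-assoc B₀ (t * k) k) (cong (B₀ +_) (+-comm (t * k) k))

  unary-Bounded : Bounded unary B₁
  unary-Bounded x i x<M i<m rewrite unary≡ x i = begin-strict
    B₀ + t * k + k′    <⟨ +-monoʳ-< (B₀ + t * k) ≤-refl ⟩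
    B₀ + t * k + k     ≡⟨ trans (+-assoc B₀ (t * k) k) (cong (B₀ +_) (+-comm (t * k) k)) ⟩
    B₀ + suc t * k     ≤⟨ +-monoʳ-≤ B₀ (*-monoˡ-≤ k (index< x<M i<m)) ⟩
    B₁                 ∎
    where
    open ≤-Reasoning
    t = index x i

  unary-Coherent : Coherent unary
  unary-Coherent x i y j rewrite unary≡ x i | unary≡ y j = λ ()

  extensions : List ExtTriple
  extensions = blocks base grid ++ levels m B₁ unary

  Γ : Formula
  Γ = bphpPow k ++ concatMap extClauses extensions

  module Unary {x i} (x<M : x < M) (i<m : i < m) where
    h = hole i
    defines : Defines Γ (chain (B₀ + index x i * k) (bitLit x h zero) (litsAt x h))
    defines {e} e∈ C∈ = ∈-++⁺ʳ (bphpPow k) (∈-concatMap⁺′ extClauses (∈-++⁺ˡ (∈-blocks (index< x<M i<m) e∈′)) C∈)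
      where
      e∈′ : e ∈ base (index x i)
      e∈′ = subst₂ (λ u w → e ∈ chain (B₀ + index x i * k) (bitLit u (hole w) zero) (litsAt u (hole w)))
              (sym (index-/ x i<m)) (sym (index-% x i<m)) e∈

    each : ∀ {l} → l ∈ notAt x h → Tree Γ k (negate (unary x i) ∷ negate l ∷ [])
    each l∈ = Tree-≡ (length-litsAt x h) (chain-each _ _ (litsAt x h) defines (∈-map⁺ negate l∈))

    all : Tree Γ k (unary x i ∷ notAt x h)
    all = Tree-≡ (length-litsAt x h) (Tree-⊑ s (chain-all _ _ (litsAt x h) defines))
      where
      twice : ∀ {l} → l ∈ litsAt x h → negate l ∈ notAt x h
      twice j with ∈-map⁻ negate j
      ... | l , l∈ , refl = subst (_∈ notAt x h) (sym (negate-negate l)) l∈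
      s : unary x i ∷ negate (bitLit x h zero) ∷ map negate (litsAt x h) ⊑ unary x i ∷ notAt x h
      s _ (here e) = here e
      s _ (there (here refl)) = there (twice (here refl))
      s _ (there (there j)) with ∈-map⁻ negate j
      ... | l , l∈ , refl = there (twice l∈)

  -- The 2k literals of the BPHP clause at hole i are cut away, each against the k cuts showing that
  -- a unary literal implies its negation.
  unary-inj : ∀ x → x < M → ∀ y → y < M → ∀ i → i < m → x ≢ y →
              Tree Γ ((k + k) * suc k + 0) (negate (unary x i) ∷ negate (unary y i) ∷ [])
  unary-inj x x<M y y<M i i<m x≢y = Tree-≡ (cong (λ n → n * suc k + 0) len)
    (cut-all (notAt x h ++ notAt y h) (leaf-∈ (∈-++⁺ˡ (∈-bphpPow⁺ h x<M y<M x≢y)) (λ _ → ∈-++⁺ˡ)) each)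
    where
    h = hole i
    len : length (notAt x h ++ notAt y h) ≡ k + k
    len = trans (length-++ (notAt x h)) (cong₂ _+_ (one x) (one y))
      where
      one : ∀ x → length (notAt x h) ≡ k
      one x = trans (sym (length-map negate (notAt x h))) (length-litsAt x h)
    each : ∀ l → l ∈ notAt x h ++ notAt y h → Tree Γ k (negate l ∷ negate (unary x i) ∷ negate (unary y i) ∷ [])
    each l j with ∈-++⁻ (notAt x h) j
    ... | inj₁ l∈ = Tree-⊑ (⊑-2 ∈1 ∈0) (Unary.each x<M i<m l∈)
    ... | inj₂ l∈ = Tree-⊑ (⊑-2 ∈2 ∈0) (Unary.each y<M i<m l∈)

  -- Query all bits of pigeon x: the answers spell some hole, and its chain yields the unary
  -- literal.
  unary-total : ∀ x → x < M → Tree Γ (bitsCost k k) (map (unary x) (upTo m))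
  unary-total x x<M = bits-tree k (pvar k x) (map (unary x) (upTo m)) at
    where
    at : ∀ h → Tree Γ k (notAt x h ++ map (unary x) (upTo m))
    at h with hole-onto h
    ... | i , i<m , refl = Tree-⊑ s (Unary.all x<M i<m)
      where
      s : unary x i ∷ notAt x (hole i) ⊑ notAt x (hole i) ++ map (unary x) (upTo m)
      s _ (here refl) = ∈-++⁺ʳ (notAt x (hole i)) (∈-map⁺ (unary x) (∈-upTo⁺ i<m))
      s _ (there j) = ∈-++⁺ˡ j

  baseCost : ℕ
  baseCost = M * bitsCost k k + M * (M * (m * ((k + k) * suc k + 0)))

  base-level : Reach ResRule Γ baseCost (Level m unary)
  base-level =
    Reach-all M (bitsCost k k) (λ x Δ → Has Δ (map (unary x) (upTo m))) (λ s → Has-mono s)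
      (λ x x<M s → derive s (unary-total x x<M)) >>= λ s₁ tot →
    Reach-map (λ s₂ inj → record { total = λ x p → Has-mono s₂ (tot x p) ; injective = inj })
      (Reach-all M (M * (m * c)) _ (λ s f y p i p′ n → Has-mono s (f y p i p′ n)) λ x x<M s₂ →
       Reach-all M (m * c) _ (λ s f i p n → Has-mono s (f i p n)) λ y y<M s₃ →
       Reach-all m c _ (λ s f n → Has-mono s (f n)) λ i i<m s₄ →
         pair x x<M y y<M i i<m (λ C j → s₄ C (s₃ C (s₂ C (s₁ C j)))))
    where
    c = (k + k) * suc k + 0
    pair : ∀ x → x < M → ∀ y → y < M → ∀ i → i < m → ∀ {Δ} → Γ ⊑ Δ →
           Reach ResRule Δ c (λ Λ → x ≢ y → Has Λ (negate (unary x i) ∷ negate (unary y i) ∷ []))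
    pair x x<M y y<M i i<m s with x ≟ y
    ... | yes e = pure (λ n → ⊥-elim (n e))
    ... | no n = Reach-map (λ _ h _ → h) (derive s (unary-inj x x<M y y<M i i<m n))

  -- The complete refutation and its size.

  refutation : ∃ λ N → N ≤ baseCost + m * levelCost + 1 × Proof ResRule Γ N
  refutation = close (base-level >>= λ s L → descend m ≤-refl
      (λ i C∈ → s _ (∈-++⁺ʳ (bphpPow k) (∈-concatMap⁺′ extClauses (∈-++⁺ʳ (blocks base grid) i) C∈))) L)
    where
    close : ∀ {n} → Reach ResRule Γ n (λ Δ → Has Δ []) → ∃ λ N → N ≤ n + 1 × Proof ResRule Γ N
    close (Δ , N , N≤ , s , inj₂ (D , D∈ , D⊑)) = N + 1 , +-monoˡ-≤ 1 N≤ , Steps-Proof s (done (⊑[]⇒[]∈ D⊑ D∈))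

  bphp-vars : ∀ {v} → Occurs v (bphpPow k) → v < B₀
  bphp-vars (D , D∈ , l , l∈ , refl) with ∈-bphpPow⁻ D∈
  ... | x , y , h , x<M , y<M , _ , refl with ∈-++⁻ (notAt x h) l∈
  ...   | inj₁ i = subst (_< B₀) (var-negate l) (bphp-var< x h x<M (∈-map⁺ negate i))
  ...   | inj₂ i = subst (_< B₀) (var-negate l) (bphp-var< y h y<M (∈-map⁺ negate i))

  cook-proof : ERProof (bphpPow k)
  cook-proof = record
    { exts  = extensions
    ; valid = Ordered-ValidExt (Ordered-++ (Ordered-blocks grid Ordered-base)
                (proj₂ (Ordered-levels m ≤-refl unary-Bounded unary-Coherent))) bphp-vars
    ; len   = proj₁ refutation
    ; res   = proj₂ (proj₂ refutation) }

  length-extensions : length extensions ≡ grid * k + m * (grid * 2)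
  length-extensions = trans (length-++ (blocks base grid))
    (cong₂ _+_ (length-blocks grid (λ t → trans (length-chain (B₀ + t * k) (bitLit (t / m) (hole (t % m)) zero) (litsAt (t / m) (hole (t % m)))) (length-litsAt (t / m) (hole (t % m))))) (length-levels m B₁ unary))

  k≤M : k ≤ M
  k≤M = m≤n⇒m≤1+n (<⇒≤ (n<2^n k))
    where
    n<2^n : ∀ n → n < 2 ^ n
    n<2^n zero    = s≤s z≤n
    n<2^n (suc n) = begin-strict
      suc n           <⟨ s≤s (n<2^n n) ⟩
      1 + 2 ^ n       ≤⟨ +-monoˡ-≤ (2 ^ n) (m^n>0 2 n) ⟩
      2 ^ n + 2 ^ n   ≡⟨ cong (2 ^ n +_) (+-identityʳ (2 ^ n)) ⟨
      2 ^ suc n       ∎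
      where open ≤-Reasoning

  -- Degree 5 comes from `unary-inj`: about M³ triples with O(k²) cuts each, where k ≤ M. Raising
  -- the lower powers to the fifth adds the coefficients up to 2 + 12 + 13 + 3 + 1 = 31.
  cook-size : erSize cook-proof ≤ 31 * M ^ 5
  cook-size = begin
    3 * length extensions + proj₁ refutation
      ≤⟨ +-mono-≤ (*-monoʳ-≤ 3 (≤-trans (≤-reflexive length-extensions) exts≤)) (proj₁ (proj₂ refutation)) ⟩
    3 * (M * M * M + M * (M * M * 2)) + (baseCost + m * levelCost + 1)
      ≤⟨ +-monoʳ-≤ (3 * (M * M * M + M * (M * M * 2))) (+-monoˡ-≤ 1 (+-mono-≤ base≤ (*-monoˡ-≤ levelCost m≤M))) ⟩
    3 * (M * M * M + M * (M * M * 2)) + (M * (M * (1 + M)) + M * (M * (M * ((M + M) * (1 + M)))) + M * levelCost + 1)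
      ≡⟨ expand M ⟩
    2 * M ^ 5 + 12 * M ^ 4 + 13 * M ^ 3 + 3 * M ^ 2 + 1
      ≤⟨ +-mono-≤ (+-mono-≤ (+-mono-≤ (+-mono-≤ (≤-refl {2 * M ^ 5})
           (*-monoʳ-≤ 12 (pow 4 (≤ᵇ⇒≤ 4 5 _)))) (*-monoʳ-≤ 13 (pow 3 (≤ᵇ⇒≤ 3 5 _))))
           (*-monoʳ-≤ 3 (pow 2 (≤ᵇ⇒≤ 2 5 _)))) (pow 0 z≤n) ⟩
    2 * M ^ 5 + 12 * M ^ 5 + 13 * M ^ 5 + 3 * M ^ 5 + M ^ 5
      ≡⟨ collect (M ^ 5) ⟩
    31 * M ^ 5 ∎
    where
    open ≤-Reasoning
    m≤M : m ≤ M
    m≤M = n≤1+n m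
    pow : ∀ e → e ≤ 5 → M ^ e ≤ M ^ 5
    pow e = ^-monoʳ-≤ M
    exts≤ : grid * k + m * (grid * 2) ≤ M * M * M + M * (M * M * 2)
    exts≤ = +-mono-≤ (*-mono-≤ (*-monoʳ-≤ M m≤M) k≤M) (*-mono-≤ m≤M (*-monoˡ-≤ 2 (*-monoʳ-≤ M m≤M)))
    bits≤ : bitsCost k k ≤ M * (1 + M)
    bits≤ = ≤-trans (n≤1+n _) (≤-trans (≤-reflexive (bitsCost-≤ k k)) (*-mono-≤ m≤M (s≤s k≤M)))
    pair≤ : (k + k) * suc k + 0 ≤ (M + M) * (1 + M)
    pair≤ = ≤-trans (≤-reflexive (+-identityʳ _)) (*-mono-≤ (+-mono-≤ k≤M k≤M) (s≤s k≤M))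
    base≤ : baseCost ≤ M * (M * (1 + M)) + M * (M * (M * ((M + M) * (1 + M))))
    base≤ = +-mono-≤ (*-monoʳ-≤ M bits≤) (*-monoʳ-≤ M (*-monoʳ-≤ M (*-mono-≤ m≤M pair≤)))
    expand : ∀ M → 3 * (M * M * M + M * (M * M * 2)) + (M * (M * (1 + M)) + M * (M * (M * ((M + M) * (1 + M))))
               + M * (M * (3 * M + 2) + M * (M * (M * 10))) + 1)
             ≡ 2 * (M * (M * (M * (M * (M * 1))))) + 12 * (M * (M * (M * (M * 1)))) + 13 * (M * (M * (M * 1))) + 3 * (M * (M * 1)) + 1
    expand = solve-∀
    collect : ∀ p → 2 * p + 12 * p + 13 * p + 3 * p + p ≡ 31 * p
    collect = solve-∀

-- The upper bound in terms of n, and the theorem.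

-- All literals of the clause are false at its hole `h`, so no two are complementary.
bphp-clauses : ∀ k .{{_ : NonZero k}} D → D ∈ bphpPow k → IsClause D
bphp-clauses k D D∈ (v , i , j) with Bits.∈-bphpPow⁻ k D∈
... | x , y , h , _ , _ , _ , refl with trans (sym (false-at (neg v) j)) (cong not (false-at (pos v) i))
  where
  open Bits k
  false-at : ∀ l → l ∈ notAt x h ++ notAt y h → litVal h l ≡ false
  false-at l i with ∈-++⁻ (notAt x h) i
  ... | inj₁ i₁ = proj₂ (∈-notAt⁻ {x} {h} i₁)
  ... | inj₂ i₂ = proj₂ (∈-notAt⁻ {y} {h} i₂)
... | ()

cook-bound : ∀ k .{{_ : NonZero k}} → Σ (ERProof (bphpPow k)) λ π → erSize π ≤ 31 * suc (2 ^ k) ^ 5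
cook-bound (suc k′) = Cook.cook-proof k′ , Cook.cook-size k′

2^log₂n≤n : ∀ n → 1 ≤ n → 2 ^ ⌊log₂ n ⌋ ≤ n
2^log₂n≤n n 1≤n = ≮⇒≥ λ n< → <-irrefl refl (log₂< ⌊log₂ n ⌋ n 1≤n n<)
  where
  -- The contrapositive, by halving n along with the power of two.
  log₂< : ∀ k n → 1 ≤ n → n < 2 ^ k → ⌊log₂ n ⌋ < k
  log₂< zero n 1≤n n<1 = ⊥-elim (<⇒≱ n<1 1≤n)
  log₂< (suc k) 1 _ _ = s≤s z≤n
  log₂< (suc k) n@(suc (suc n₀)) _ n< = s≤s (≤-trans (n≤1+n∸1 ⌊log₂ n ⌋)
    (subst (_< k) (⌊log₂⌊n/2⌋⌋≡⌊log₂n⌋∸1 n) (log₂< k ⌊ n /2⌋ (s≤s z≤n) half)))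
    where
    n≤1+n∸1 : ∀ a → a ≤ suc (a ∸ 1)
    n≤1+n∸1 zero    = z≤n
    n≤1+n∸1 (suc a) = ≤-refl
    half : ⌊ n /2⌋ < 2 ^ k
    half = *-cancelˡ-< 2 ⌊ n /2⌋ (2 ^ k) (≤-<-trans (begin
      2 * ⌊ n /2⌋           ≡⟨ cong (⌊ n /2⌋ +_) (+-identityʳ _) ⟩
      ⌊ n /2⌋ + ⌊ n /2⌋     ≤⟨ +-monoʳ-≤ ⌊ n /2⌋ (⌊n/2⌋≤⌈n/2⌉ n) ⟩
      ⌊ n /2⌋ + ⌈ n /2⌉     ≡⟨ ⌊n/2⌋+⌈n/2⌉≡n n ⟩
      n                     ∎) n<)
      where open ≤-Reasoning

module _ {n} (2≤n : 2 ≤ n) where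
  log₂-nonZero : NonZero ⌊log₂ n ⌋
  log₂-nonZero = >-nonZero (subst (_≤ ⌊log₂ n ⌋) (⌊log₂[2^n]⌋≡n 1) (⌊log₂⌋-mono-≤ 2≤n))

  upper-bound : (π : ERProof (BPHP n)) → (∀ π′ → erSize π ≤ erSize π′) →
                Σ ℕ λ N → N ≤ 992 * n ^ 5 × RAT⁻Proof (𝒢 (BPHP n) π) N
  upper-bound π minimal = N , ≤-trans N≤ (≤-trans (minimal π₀) (≤-trans π₀≤ poly)) , p
    where
    k = ⌊log₂ n ⌋
    instance
      k≢0 : NonZero k
      k≢0 = log₂-nonZero
    π₀ : ERProof (BPHP n)
    π₀ = proj₁ (cook-bound k)
    π₀≤ : erSize π₀ ≤ 31 * suc (2 ^ k) ^ 5
    π₀≤ = proj₂ (cook-bound k)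
    simulated : ∃ λ N → N ≤ erSize π × RAT⁻Proof (𝒢 (BPHP n) π) N
    simulated = Simulate.RAT⁻-simulates-ER π (bphp-clauses k)
      (Bits.∈-bphpPow⁺ k {0} {1} (replicate k true) (s≤s z≤n) (s≤s (m^n>0 2 k)) λ ())
    N = proj₁ simulated
    N≤ = proj₁ (proj₂ simulated)
    p = proj₂ (proj₂ simulated)
    -- From 2^k + 1 ≤ 2n, with 992 = 31 · 2^5.
    poly : 31 * suc (2 ^ k) ^ 5 ≤ 992 * n ^ 5
    poly = begin
      31 * suc (2 ^ k) ^ 5   ≤⟨ *-monoʳ-≤ 31 (^-monoˡ-≤ 5 (+-mono-≤ (≤-trans (s≤s z≤n) 2≤n) (2^log₂n≤n n (≤-trans (s≤s z≤n) 2≤n)))) ⟩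
      31 * (n + n) ^ 5       ≡⟨ cong (λ a → 31 * (n + a) ^ 5) (+-identityʳ n) ⟨
      31 * (2 * n) ^ 5       ≡⟨ cong (31 *_) (^-distribʳ-* 5 2 n) ⟩
      31 * (32 * n ^ 5)      ≡⟨ *-assoc 31 32 (n ^ 5) ⟨
      992 * n ^ 5            ∎
      where open ≤-Reasoning

theorem24 : (choice : (n : ℕ) → 2 ≤ n → ERProof (BPHP n)) →
    (∀ n (h : 2 ≤ n) (π : ERProof (BPHP n)) → erSize (choice n h) ≤ erSize π) →
    (Σ ℕ λ c → Σ ℕ λ d → Σ ℕ λ n₀ → ∀ n (h : 2 ≤ n) → n₀ ≤ n →
    Σ ℕ λ N → N ≤ d * n ^ c × RAT⁻Proof (𝒢 (BPHP n) (choice n h)) N)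
    × (Σ ℕ λ c → Σ ℕ λ n₀ → ∀ n (h : 2 ≤ n) → n₀ ≤ n →
    ∀ N → SBC⁻Proof (𝒢 (BPHP n) (choice n h)) N → 2 ^ n ≤ N ^ c)
theorem24 choice minimal =
    (5 , 992 , 2 , λ n h _ → upper-bound h (choice n h) (minimal n h))
  , (256 , 128 , λ n h 128≤n → lower-bound n 128≤n (choice n h))
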